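{- Let $r,t,c$ be positive integers with $r\ge 2$ and $t\ge c\ge 1$. Let $a(r,c)=\left(r^r+1-\frac1r\right)(c-1)$. Let $T$ be a tight $r$-tree with $t$ edges and $c(T)\le c$. If $G$ is an $r$-graph that does not contain $T$, then $$e(G)\le\left(\frac{t-1}{r}+a(r,c)\right)|\partial(G)|.$$
   Context: An $r$-graph is a (finite) $r$-uniform hypergraph; $e(G)$ is the number of edges of $G$. The shadow of an $r$-graph $G$ is $\partial(G)=\{S: |S|=r-1,\ S\subseteq e\text{ for some }e\in E(G)\}$. An $r$-graph $T$ is a tight $r$-tree if its edges can be ordered as $e_1,\dots,e_t$ so that: (*) for each $i\ge 2$ there are a vertex $v\in e_i$ and an index $1\le s\le i-1$ such that $v\notin\bigcup_{j=1}^{i-1}e_j$ and $e_i\setminus\{v\}\subset e_s$. The vertex set of a tight tree is the union of its edges. Given a tight $r$-tree $T$ and a tight subtree $T'$ of $T$ (a subgraph of $T$ that is itself a tight $r$-tree), $T'$ is a trunk of $T$ if there is an ordering of the edges of $T$ satisfying (*) in which the edges of $T'$ are listed first, and for each $e\in E(T)\setminus E(T')$ there exists $e'\in E(T')$ with $|e\cap e'|=r-1$. $c(T)$ denotes the minimum number of edges in a trunk of $T$. An $r$-graph $G$ contains $T$ if there is an injection $V(T)\to V(G)$ mapping every edge of $T$ to an edge of $G$. -}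

module Defs where

open import Data.Empty using (⊥)
open import Data.Fin using (Fin; toℕ)
open import Data.Fin.Properties using (any?; _≟_)
open import Data.Fin.Subset using (Subset; inside; outside; _∈_; _∉_; _⊆_; _∩_; _-_; ⋃; ∣_∣)
open import Data.Fin.Subset.Properties using (_∈?_; _⊆?_)
import Data.Integer as ℤ
open import Data.List using (List; []; _∷_; _++_; map; filter; take; length; lookup)
open import Data.List.Membership.Propositional using () renaming (_∈_ to _∈ₗ_; _∉_ to _∉ₗ_)
open import Data.List.Membership.Propositional.Properties using (∈-map⁻)
open import Data.List.Relation.Binary.Permutation.Propositional using (_↭_)
open import Data.List.Relation.Binary.Subset.Propositional using () renaming (_⊆_ to _⊆ₗ_)
open import Data.List.Relation.Unary.All using (All; []; _∷_)
import Data.List.Relation.Unary.All as All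
open import Data.List.Relation.Unary.All.Properties using (all-filter)
open import Data.List.Relation.Unary.AllPairs using ([]; _∷_)
open import Data.List.Relation.Unary.Any using (Any)
import Data.List.Relation.Unary.Any as Any
open import Data.List.Relation.Unary.Unique.Propositional using (Unique)
open import Data.List.Relation.Unary.Unique.Propositional.Properties using (map⁺; ++⁺; filter⁺)
open import Data.Nat as ℕ using (ℕ; zero; suc; _∸_; _≤_; NonZero)
open import Data.Product using (∃; ∃-syntax; _×_; _,_; proj₁)
open import Data.Rational as ℚ using (ℚ; 1ℚ)
import Data.Vec as Vec
import Data.Vec.Properties as Vec
open import Relation.Binary.PropositionalEquality using (_≡_; refl; trans; sym)
open import Relation.Nullary using (Dec; does)
open import Relation.Nullary.Decidable using (_×-dec_)

private
  variable
    m n r : ℕ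

record RGraph (r n : ℕ) : Set where
  field
    edges   : List (Subset n)
    unique  : Unique edges
    uniform : All (λ e → ∣ e ∣ ≡ r) edges

open RGraph public

e : RGraph r n → ℕ
e G = length (edges G)

subsets : ∀ n → List (Subset n)
subsets zero    = Vec.[] ∷ []
subsets (suc n) = map (outside Vec.∷_) (subsets n) ++ map (inside Vec.∷_) (subsets n)

subsets-unique : ∀ n → Unique (subsets n)
subsets-unique zero    = [] ∷ []
subsets-unique (suc n) =
  ++⁺ (map⁺ Vec.∷-injectiveʳ (subsets-unique n)) (map⁺ Vec.∷-injectiveʳ (subsets-unique n))
      λ (p , q) → disjoint (∈-map⁻ _ p) (∈-map⁻ _ q)
  where
  disjoint : ∀ {S : Subset (suc n)} →
             (∃[ x ] x ∈ₗ subsets n × S ≡ outside Vec.∷ x) →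
             (∃[ y ] y ∈ₗ subsets n × S ≡ inside Vec.∷ y) → ⊥
  disjoint (_ , _ , p) (_ , _ , q) with trans (sym p) q
  ... | ()

InShadow : RGraph r n → Subset n → Set
InShadow {r} G S = ∣ S ∣ ≡ r ∸ 1 × Any (S ⊆_) (edges G)

inShadow? : (G : RGraph r n) (S : Subset n) → Dec (InShadow G S)
inShadow? {r} G S = (∣ S ∣ ℕ.≟ r ∸ 1) ×-dec Any.any? (S ⊆?_) (edges G)

∂ : RGraph r n → RGraph (r ∸ 1) n
∂ {n = n} G = record
  { edges   = filter (inShadow? G) (subsets n)
  ; unique  = filter⁺ (inShadow? G) (subsets-unique n)
  ; uniform = All.map proj₁ (all-filter (inShadow? G) (subsets n))
  }

-- Positions count from 0, so `take (toℕ i) es` lists the edges before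
-- the one at position i.
TightOrder : List (Subset n) → Set
TightOrder es =
  (i : Fin (length es)) → 1 ≤ toℕ i →
  ∃[ v ] v ∈ lookup es i
       × v ∉ ⋃ (take (toℕ i) es)
       × Any (λ eₛ → (lookup es i - v) ⊆ eₛ) (take (toℕ i) es)

TightTree : RGraph r n → Set
TightTree T = ∃[ es ] es ↭ edges T × TightOrder es

-- The ambient type Fin n may contain points outside the vertex set of a
-- tight tree, so that a tree and its subtrees share one ambient type.
V : RGraph r n → Subset n
V T = ⋃ (edges T)

record Trunk (T′ T : RGraph r n) : Set where
  field
    subgraph : edges T′ ⊆ₗ edges T
    tree     : TightTree T′
    ordering : ∃[ es′ ] ∃[ es ] es′ ↭ edges T′
                              × es′ ++ es ↭ edges T
                              × TightOrder (es′ ++ es)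
    adjacent : ∀ {f} → f ∈ₗ edges T → f ∉ₗ edges T′ →
               ∃[ f′ ] f′ ∈ₗ edges T′ × ∣ f ∩ f′ ∣ ≡ r ∸ 1

-- c(T) = k.
record MinTrunkSize (T : RGraph r n) (k : ℕ) : Set where
  field
    attained : ∃[ T′ ] Trunk T′ T × e T′ ≡ k
    minimal  : ∀ T′ → Trunk T′ T → k ≤ e T′

image : (Fin m → Fin n) → Subset m → Subset n
image φ S = Vec.tabulate λ y → does (any? λ x → (x ∈? S) ×-dec (φ x ≟ y))

-- φ encodes a map defined on V T: only its values there are constrained.  It
-- can be extended to Fin m whenever T has a nonempty edge.
record Contains (G : RGraph r n) (T : RGraph r m) : Set where
  field
    φ         : Fin m → Fin n
    injective : ∀ {x y} → x ∈ V T → y ∈ V T → φ x ≡ φ y → x ≡ y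
    edge      : ∀ {f} → f ∈ₗ edges T → image φ f ∈ₗ edges G

fromℕ : ℕ → ℚ
fromℕ k = ℤ.+ k ℚ./ 1

a : (r c : ℕ) → .{{NonZero r}} → ℚ
a r c = (fromℕ (r ℕ.^ r) ℚ.+ 1ℚ ℚ.- (ℤ.+ 1 ℚ./ r)) ℚ.* (fromℕ c ℚ.- 1ℚ)

{-# OPTIONS --safe #-}

-- Give a facet S of G the weight 1/d(S).  These weights sum to |∂G| over all
-- pairs of an edge and one of its facets, so if e(G) is too large, more than
-- r^r (c - 1)|∂G| edges are light: the facets of such an edge weigh less than
-- r/N together, where N = t - 1 + (r - 1)(c - 1).  In a light edge the i-th
-- smallest facet degree exceeds iN/r.  Some colouring of V(G) by r colours
-- assigns to every vertex of at least an r^{-r} fraction of the light edges the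
-- rank of the degree of the opposite facet, and these edges contain a nonempty
-- subgraph H with all positive codegrees at least c.  Colour the trunk properly,
-- with the colours ordered by the number of leaf edges attached opposite to
-- them.  The trunk embeds greedily into H, preserving colours, and the leaf
-- edges are then added in G in increasing order of colour: the i smallest
-- colours carry at most i(t - k)/r of the leaf edges, where k is the number of
-- edges of the trunk, so there is always room.
module Submission where

open import Defs
open import Data.Bool using (Bool; if_then_else_)
import Data.Bool.Properties as Bool
open import Data.Fin using (Fin; zero; suc; toℕ; fromℕ<)
open import Data.Fin.Properties using (suc-injective; 0≢1+n; _≟_; toℕ-fromℕ<; toℕ<n; toℕ-injective)
  renaming (any? to any?ᶠ)
open import Data.Fin.Subset
  using (Subset; inside; outside; _∈_; _∉_; _⊆_; _∩_; _∪_; _-_; _─_; ⋃; ⊤; ∣_∣; ⁅_⁆)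
open import Data.Fin.Subset.Properties
import Data.Integer as ℤ
import Data.Integer.Properties as ℤ
open import Data.List using (List; []; _∷_; _++_; _ʳ++_; map; filter; length; lookup; take; tabulate; allFin)
open import Data.List.Membership.Propositional using (lose; find) renaming (_∈_ to _∈ₗ_; _∉_ to _∉ₗ_)
open import Data.List.Membership.Propositional.Properties
  using (∈-∃++; ∈-map⁺; ∈-map⁻; ∈-filter⁺; ∈-filter⁻; ∈-allFin; ∈-++⁺ˡ; ∈-++⁺ʳ; ∈-++⁻)
open import Data.List.Properties
  using (map-∘; length-map; length-tabulate; length-filter; length-++; length-ʳ++; filter-notAll; filter-all)
open import Data.List.Relation.Binary.Permutation.Propositional using (_↭_; ↭-sym; ↭⇒↭ₛ)
open import Data.List.Relation.Binary.Permutation.Propositional.Properties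
  using (shift; ∈-resp-↭; map⁺; ↭-length; filter-↭)
open import Data.List.Relation.Binary.Permutation.Setoid.Properties using (AllPairs-resp-↭)
open import Data.List.Relation.Binary.Subset.Propositional using () renaming (_⊆_ to _⊆ₗ_)
open import Data.List.Relation.Unary.All using (All; []; _∷_)
import Data.List.Relation.Unary.All as All
import Data.List.Relation.Unary.All.Properties as All
open import Data.List.Relation.Unary.AllPairs using (AllPairs; []; _∷_)
open import Data.List.Relation.Unary.Any using (Any; here; there; any?)
import Data.List.Relation.Unary.Any as Any
import Data.List.Relation.Unary.Linked.Properties as Linked
open import Data.List.Relation.Unary.Unique.Propositional using (Unique)
import Data.List.Relation.Unary.Unique.Propositional.Properties as Unique
import Data.List.Sort as Sort
open import Data.Nat
  using (ℕ; zero; suc; pred; _+_; _*_; _^_; _!; _/_; _≤_; _<_; _≥_; z≤n; s≤s; _≤?_; _<?_; NonZero)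
import Data.Nat as ℕ
open import Data.Nat.DivMod using (/-monoʳ-≤; m/n≤m; m/n*n≡m)
open import Data.Nat.Divisibility using (m≤n⇒m!∣n!; ∣-trans; m∣m*n)
open import Data.Nat.ListAction using (sum)
open import Data.Nat.ListAction.Properties using (sum-↭)
open import Data.Nat.Properties hiding (0≢1+n; _≟_; suc-injective)
open import Algebra.Properties.CommutativeSemigroup +-commutativeSemigroup using (interchange; xy∙z≈xz∙y)
open import Algebra.Properties.CommutativeSemigroup *-commutativeSemigroup using (x∙yz≈y∙xz)
open import Data.Product using (∃-syntax; Σ-syntax; _×_; _,_; proj₁; proj₂)
open import Data.Rational as ℚ using (ℚ; 1ℚ; toℚᵘ)
import Data.Rational.Properties as ℚ
open import Data.Rational.Solver using (module +-*-Solver)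
open import Data.Rational.Unnormalised as ℚᵘ using (mkℚᵘ; *≡*; *≤*)
import Data.Rational.Unnormalised.Properties as ℚᵘ
open import Data.Sum using (_⊎_; inj₁; inj₂)
import Data.Sum as Sum
import Data.Unit as Unit
open import Data.Vec using ([]; _∷_; here; there)
import Data.Vec as Vec
open import Data.Vec.Functional using (updateAt)
open import Data.Vec.Functional.Properties using (updateAt-updates; updateAt-minimal)
import Data.Vec.Properties as Vec
open import Function using (_∘_; id; const)
open import Relation.Binary using (Symmetric; tri<; tri≈; tri>)
import Relation.Binary.Construct.Flip.EqAndOrd as Flip
import Relation.Binary.Construct.On as On
open import Relation.Binary.PropositionalEquality
  using (_≡_; _≢_; refl; sym; trans; cong; cong₂; subst; subst₂; ≢-sym; setoid; resp₂; module ≡-Reasoning)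
open import Relation.Nullary using (¬_; Dec; yes; no; does; contradiction)
open import Relation.Nullary.Decidable using (decidable-stable; _×-dec_; ¬?; dec-true)
open import Relation.Unary using (Decidable)

-- Lightness bounds the facets of an edge only on average: its smallest facet may have degree barely
-- above N/r, while all leaf edges may hang on one kind of facet of the trunk. So crowded facets of
-- the trunk must land on facets of large degree. But the rank of a facet depends on the edge in
-- which it is read, which a greedy embedding cannot control; the colouring makes it a property of
-- the opposite vertex. Two edges of H sharing a facet then have equally coloured remaining
-- vertices, so the colours of the first trunk edge propagate along the whole trunk. The price is
-- the factor r^r.
--
-- The size of N comes from the smallest colour. When the last leaf edge of the i smallest colours
-- is placed, at most k trunk vertices off its facet and i(t - k)/r - 1 tips are occupied, so r(k -
-- 1) + i(t - k) ≤ iN suffices; i = 1 with k = c is the tightest case. Heavy edges then number at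
-- most N/r = (t - 1)/r + (1 - 1/r)(c - 1) per member of ∂G; adding r^r (c - 1) for the light ones
-- gives the claimed bound.

private
  variable
    A B : Set
    m n : ℕ

-- Finite sums over lists.

∑ : List A → (A → ℕ) → ℕ
∑ xs f = sum (map f xs)

syntax ∑ xs (λ x → f) = ∑[ x ← xs ] f

𝟙 : {P : Set} → Dec P → ℕ
𝟙 P? = if does P? then 1 else 0

𝟙-true : {P : Set} (P? : Dec P) → P → 𝟙 P? ≡ 1
𝟙-true P? p = cong (λ b → if b then 1 else 0) (dec-true P? p)

∑-cong : ∀ (xs : List A) {f g : A → ℕ} → (∀ {x} → x ∈ₗ xs → f x ≡ g x) → ∑ xs f ≡ ∑ xs g
∑-cong []       _   = refl
∑-cong (x ∷ xs) f≡g = cong₂ _+_ (f≡g (here refl)) (∑-cong xs (f≡g ∘ there))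

∑-mono : ∀ (xs : List A) {f g : A → ℕ} → (∀ {x} → x ∈ₗ xs → f x ≤ g x) → ∑ xs f ≤ ∑ xs g
∑-mono []       _   = z≤n
∑-mono (x ∷ xs) f≤g = +-mono-≤ (f≤g (here refl)) (∑-mono xs (f≤g ∘ there))

∑-const : ∀ (xs : List A) k → ∑[ _ ← xs ] k ≡ length xs * k
∑-const []       k = refl
∑-const (x ∷ xs) k = cong (k +_) (∑-const xs k)

∑-+ : ∀ (xs : List A) (f g : A → ℕ) → ∑[ x ← xs ] (f x + g x) ≡ ∑ xs f + ∑ xs g
∑-+ []       f g = refl
∑-+ (x ∷ xs) f g = trans (cong (f x + g x +_) (∑-+ xs f g)) (interchange (f x) (g x) _ _)

∑-*ˡ : ∀ (xs : List A) k (f : A → ℕ) → ∑[ x ← xs ] (k * f x) ≡ k * ∑ xs f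
∑-*ˡ []       k f = sym (*-zeroʳ k)
∑-*ˡ (x ∷ xs) k f = trans (cong (k * f x +_) (∑-*ˡ xs k f)) (sym (*-distribˡ-+ k (f x) _))

∑-swap : ∀ (xs : List A) (ys : List B) (f : A → B → ℕ) →
         ∑[ x ← xs ] ∑[ y ← ys ] f x y ≡ ∑[ y ← ys ] ∑[ x ← xs ] f x y
∑-swap []       ys f = sym (trans (∑-const ys 0) (*-zeroʳ (length ys)))
∑-swap (x ∷ xs) ys f = trans (cong (∑ ys (f x) +_) (∑-swap xs ys f))
                             (sym (∑-+ ys (f x) (λ y → ∑[ x′ ← xs ] f x′ y)))

∑-filter : {P : A → Set} (P? : Decidable P) (xs : List A) (f : A → ℕ) →
           ∑ (filter P? xs) f ≡ ∑[ x ← xs ] (f x * 𝟙 (P? x))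
∑-filter P? []       f = refl
∑-filter P? (x ∷ xs) f with P? x
... | yes _ = cong₂ _+_ (sym (*-identityʳ (f x))) (∑-filter P? xs f)
... | no  _ = cong₂ _+_ (sym (*-zeroʳ (f x))) (∑-filter P? xs f)

length-filter≡∑ : {P : A → Set} (P? : Decidable P) (xs : List A) →
                  length (filter P? xs) ≡ ∑[ x ← xs ] 𝟙 (P? x)
length-filter≡∑ P? []       = refl
length-filter≡∑ P? (x ∷ xs) with P? x
... | yes _ = cong suc (length-filter≡∑ P? xs)
... | no  _ = length-filter≡∑ P? xs

length≡∑ : (xs : List A) → length xs ≡ ∑[ _ ← xs ] 1
length≡∑ xs = sym (trans (∑-const xs 1) (*-identityʳ _))

∈⇒≤∑ : ∀ (f : A → ℕ) {x xs} → x ∈ₗ xs → f x ≤ ∑ xs f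
∈⇒≤∑ f (here refl)           = m≤m+n _ _
∈⇒≤∑ f (there {x = y} x∈xs) = ≤-trans (∈⇒≤∑ f x∈xs) (m≤n+m _ (f y))

∑-⊆ : ∀ {xs ys : List A} (f : A → ℕ) → Unique xs → xs ⊆ₗ ys → ∑ xs f ≤ ∑ ys f
∑-⊆ {xs = []}     f _            _     = z≤n
∑-⊆ {xs = x ∷ xs} f (x∉xs ∷ uxs) xs⊆ys with ∈-∃++ (xs⊆ys (here refl))
... | ws , zs , refl = subst (∑ (x ∷ xs) f ≤_) (sym (sum-↭ (map⁺ f (shift x ws zs))))
                             (+-monoʳ-≤ (f x) (∑-⊆ f uxs xs⊆ws++zs))
  where
  xs⊆ws++zs : xs ⊆ₗ ws ++ zs
  xs⊆ws++zs y∈xs with ∈-resp-↭ (shift x ws zs) (xs⊆ys (there y∈xs))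
  ... | here refl = contradiction refl (All.lookup x∉xs y∈xs)
  ... | there y∈  = y∈

length-⊆ : ∀ {xs ys : List A} → Unique xs → xs ⊆ₗ ys → length xs ≤ length ys
length-⊆ {xs = xs} {ys} uxs xs⊆ys rewrite length≡∑ xs | length≡∑ ys = ∑-⊆ (λ _ → 1) uxs xs⊆ys

max-≥-average : ∀ (f : A → ℕ) x xs → ∃[ y ] ∑ (x ∷ xs) f ≤ length (x ∷ xs) * f y
max-≥-average f x []        = x , ≤-refl
max-≥-average f x (x′ ∷ xs) with max-≥-average f x′ xs
... | y , le with ≤-total (f x) (f y)
... | inj₁ fx≤fy = y , +-mono-≤ fx≤fy le
... | inj₂ fy≤fx = x , +-monoʳ-≤ (f x) (≤-trans le (*-monoʳ-≤ (length (x′ ∷ xs)) fy≤fx))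

-- Subsets of a finite set: enumeration, facets, images.

elements : Subset n → List (Fin n)
elements []            = []
elements (inside  ∷ p) = zero ∷ map suc (elements p)
elements (outside ∷ p) = map suc (elements p)

length-elements : (p : Subset n) → length (elements p) ≡ ∣ p ∣
length-elements []            = refl
length-elements (inside  ∷ p) = cong suc (trans (length-map suc (elements p)) (length-elements p))
length-elements (outside ∷ p) = trans (length-map suc (elements p)) (length-elements p)

∈-elements⁺ : ∀ {x} {p : Subset n} → x ∈ p → x ∈ₗ elements p
∈-elements⁺ {p = inside  ∷ p} here       = here refl
∈-elements⁺ {p = inside  ∷ p} (there x∈) = there (∈-map⁺ suc (∈-elements⁺ x∈))
∈-elements⁺ {p = outside ∷ p} (there x∈) = ∈-map⁺ suc (∈-elements⁺ x∈)

∈-elements⁻ : ∀ {x} {p : Subset n} → x ∈ₗ elements p → x ∈ p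
∈-elements⁻ {p = inside  ∷ p} (here refl) = here
∈-elements⁻ {p = inside  ∷ p} (there x∈) with ∈-map⁻ suc x∈
... | _ , y∈ , refl = there (∈-elements⁻ y∈)
∈-elements⁻ {p = outside ∷ p} x∈ with ∈-map⁻ suc x∈
... | _ , y∈ , refl = there (∈-elements⁻ y∈)

elements-unique : (p : Subset n) → Unique (elements p)
elements-unique []            = []
elements-unique (inside  ∷ p) = All.map⁺ (All.universal (λ _ → 0≢1+n) _)
                              ∷ Unique.map⁺ suc-injective (elements-unique p)
elements-unique (outside ∷ p) = Unique.map⁺ suc-injective (elements-unique p)

⊆∧∣≥∣⇒≡ : {p q : Subset n} → p ⊆ q → ∣ q ∣ ≤ ∣ p ∣ → p ≡ q
⊆∧∣≥∣⇒≡ {p = p} {q} p⊆q ∣q∣≤∣p∣ with p ⊂? q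
... | yes p⊂q = contradiction ∣q∣≤∣p∣ (<⇒≱ (p⊂q⇒∣p∣<∣q∣ p⊂q))
... | no  p⊄q = ⊆-antisym p⊆q λ {x} x∈q → decidable-stable (x ∈? p) λ x∉p → p⊄q (p⊆q , x , x∈q , x∉p)

p-x⊆p : {p : Subset n} {x : Fin n} → p - x ⊆ p
p-x⊆p {p = p} {x} = p─q⊆p p ⁅ x ⁆

x∈p─q⇒x∉q : ∀ {p q : Subset n} {x} → x ∈ p ─ q → x ∉ q
x∈p─q⇒x∉q {p = _ ∷ p} {_ ∷ q} (there x∈) (there x∈q) = x∈p─q⇒x∉q x∈ x∈q

x∉p-x : {p : Subset n} {x : Fin n} → x ∉ p - x
x∉p-x {x = x} x∈ = x∈p─q⇒x∉q x∈ (x∈⁅x⁆ x)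

x∈p⇒∣p∣≡1+∣p-x∣ : {p : Subset n} {x : Fin n} → x ∈ p → ∣ p ∣ ≡ suc ∣ p - x ∣
x∈p⇒∣p∣≡1+∣p-x∣ {p = p} {x} x∈p = ≤-antisym ∣p∣≤ (x∈p⇒∣p-x∣<∣p∣ x∈p)
  where
  covered : elements p ⊆ₗ x ∷ elements (p - x)
  covered {y} y∈ with y ≟ x
  ... | yes refl = here refl
  ... | no  y≢x  = there (∈-elements⁺ (x∈p∧x≢y⇒x∈p-y (∈-elements⁻ {p = p} y∈) y≢x))
  ∣p∣≤ : ∣ p ∣ ≤ suc ∣ p - x ∣
  ∣p∣≤ = subst₂ _≤_ (length-elements p) (cong suc (length-elements (p - x)))
                (length-⊆ (elements-unique p) covered)

facet-of : ∀ {A p : Subset n} → A ⊆ p → ∣ p ∣ ≡ suc ∣ A ∣ → ∃[ x ] x ∈ p × A ≡ p - x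
facet-of {A = A} {p} A⊆p ∣p∣≡ with any?ᶠ (λ x → (x ∈? p) ×-dec ¬? (x ∈? A))
... | yes (x , x∈p , x∉A) =
  x , x∈p , ⊆∧∣≥∣⇒≡ (λ y∈A → x∈p∧x≢y⇒x∈p-y (A⊆p y∈A) λ { refl → x∉A y∈A })
                     (≤-pred (≤-reflexive (trans (sym (x∈p⇒∣p∣≡1+∣p-x∣ x∈p)) ∣p∣≡)))
... | no  none = contradiction (p⊆q⇒∣p∣≤∣q∣ p⊆A) (<⇒≱ (≤-reflexive (sym ∣p∣≡)))
  where
  p⊆A : p ⊆ A
  p⊆A {x} x∈p = decidable-stable (x ∈? A) λ x∉A → none (x , x∈p , x∉A)

-‿injective : ∀ {p q : Subset n} {x} → x ∈ p → x ∈ q → p - x ≡ q - x → p ≡ q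
-‿injective {p = p} {q} {x} x∈p x∈q eq = ⊆-antisym (p⊆q x∈q eq) (p⊆q x∈p (sym eq))
  where
  p⊆q : ∀ {p q} → x ∈ q → p - x ≡ q - x → p ⊆ q
  p⊆q x∈q eq {y} y∈p with y ≟ x
  ... | yes refl = x∈q
  ... | no  y≢x  = p-x⊆p (subst (y ∈_) eq (x∈p∧x≢y⇒x∈p-y y∈p y≢x))

InjectiveOn : {A : Set} → Subset n → (Fin n → A) → Set
InjectiveOn p f = ∀ {x y} → x ∈ p → y ∈ p → f x ≡ f y → x ≡ y

injectiveOn-unique : ∀ {p : Subset n} {f : Fin n → A} → InjectiveOn p f → Unique (map f (elements p))
injectiveOn-unique {p = p} {f} inj = helper (elements p) (elements-unique p) ∈-elements⁻
  where
  helper : ∀ xs → Unique xs → (∀ {x} → x ∈ₗ xs → x ∈ p) → Unique (map f xs)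
  helper []       _            _    = []
  helper (x ∷ xs) (x∉xs ∷ uxs) xs⊆p =
    All.map⁺ (All.tabulate λ y∈xs fx≡fy →
      All.lookup x∉xs y∈xs (inj (xs⊆p (here refl)) (xs⊆p (there y∈xs)) fx≡fy))
    ∷ helper xs uxs (xs⊆p ∘ there)

module _ {m n : ℕ} (φ : Fin m → Fin n) where

  ∈-image⁺ : ∀ {p x} → x ∈ p → φ x ∈ image φ p
  ∈-image⁺ {p} {x} x∈p = Vec.lookup⇒[]= _ _ (trans (Vec.lookup∘tabulate _ (φ x))
    (dec-true (any?ᶠ λ x′ → (x′ ∈? p) ×-dec (φ x′ ≟ φ x)) (x , x∈p , refl)))

  ∈-image⁻ : ∀ {p y} → y ∈ image φ p → ∃[ x ] x ∈ p × φ x ≡ y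
  ∈-image⁻ {p} {y} y∈ with any?ᶠ (λ x → (x ∈? p) ×-dec (φ x ≟ y))
                         | trans (sym (Vec.lookup∘tabulate _ y)) (Vec.[]=⇒lookup y∈)
  ... | yes found | _ = found
  ... | no  _     | ()

  ∣image∣ : ∀ {p} → InjectiveOn p φ → ∣ p ∣ ≤ ∣ image φ p ∣
  ∣image∣ {p} inj = subst₂ _≤_ (trans (length-map φ (elements p)) (length-elements p)) (length-elements (image φ p))
    (length-⊆ (injectiveOn-unique inj) λ y∈ → let x , x∈ , eq = ∈-map⁻ φ y∈ in
      ∈-elements⁺ (subst (_∈ image φ p) (sym eq) (∈-image⁺ (∈-elements⁻ x∈))))

  image-- : ∀ {p u} → u ∈ p → InjectiveOn p φ → image φ (p - u) ≡ image φ p - φ u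
  image-- {p} {u} u∈p inj = ⊆-antisym ⊆₁ ⊆₂
    where
    ⊆₁ : image φ (p - u) ⊆ image φ p - φ u
    ⊆₁ y∈ with ∈-image⁻ y∈
    ... | x , x∈ , refl = x∈p∧x≢y⇒x∈p-y (∈-image⁺ (p-x⊆p x∈))
      λ eq → x∉p-x (subst (_∈ p - u) (inj (p-x⊆p x∈) u∈p eq) x∈)
    ⊆₂ : image φ p - φ u ⊆ image φ (p - u)
    ⊆₂ y∈ with ∈-image⁻ (p-x⊆p y∈)
    ... | x , x∈p , refl = ∈-image⁺ (x∈p∧x≢y⇒x∈p-y x∈p λ { refl → x∉p-x y∈ })

image-cong : ∀ {m n} {φ ψ : Fin m → Fin n} {p} → (∀ {x} → x ∈ p → φ x ≡ ψ x) → image φ p ≡ image ψ p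
image-cong {p = p} φ≡ψ = ⊆-antisym (⊆₁ φ≡ψ) (⊆₁ (sym ∘ φ≡ψ))
  where
  ⊆₁ : ∀ {m n} {φ ψ : Fin m → Fin n} {p} → (∀ {x} → x ∈ p → φ x ≡ ψ x) → image φ p ⊆ image ψ p
  ⊆₁ {φ = φ} {ψ} {p} φ≡ψ y∈ with ∈-image⁻ φ y∈
  ... | x , x∈p , refl = subst (_∈ image ψ p) (sym (φ≡ψ x∈p)) (∈-image⁺ ψ x∈p)

-- Ranking the elements of a set by a numerical key.

-- Ties in d are broken by the order of Fin n.
module Rank {n : ℕ} (p : Subset n) (d : Fin n → ℕ) where

  key : Fin n → ℕ
  key u = d u * n + toℕ u

  key-mono : ∀ {u v} → d u < d v → key u < key v
  key-mono {u} {v} d<d′ = begin-strict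
    d u * n + toℕ u   <⟨ +-monoʳ-< (d u * n) (toℕ<n u) ⟩
    d u * n + n       ≡⟨ +-comm (d u * n) n ⟩
    suc (d u) * n     ≤⟨ *-monoˡ-≤ n d<d′ ⟩
    d v * n           ≤⟨ m≤m+n (d v * n) (toℕ v) ⟩
    d v * n + toℕ v   ∎
    where open ≤-Reasoning

  key-cancel-≤ : ∀ {u v} → key u ≤ key v → d u ≤ d v
  key-cancel-≤ ku≤kv = ≮⇒≥ λ dv<du → <⇒≱ (key-mono dv<du) ku≤kv

  key-injective : ∀ {u v} → key u ≡ key v → u ≡ v
  key-injective {u} {v} eq = toℕ-injective (+-cancelˡ-≡ (d v * n) _ _
    (subst (λ k → k * n + toℕ u ≡ key v) du≡dv eq))
    where
    du≡dv : d u ≡ d v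
    du≡dv = ≤-antisym (key-cancel-≤ (≤-reflexive eq)) (key-cancel-≤ (≤-reflexive (sym eq)))

  below : Fin n → List (Fin n)
  below v = filter (λ u → key u <? key v) (elements p)

  rank : Fin n → ℕ
  rank v = length (below v)

  ∈-below⁻ : ∀ {u v} → u ∈ₗ below v → u ∈ₗ elements p × key u < key v
  ∈-below⁻ {v = v} = ∈-filter⁻ (λ u → key u <? key v) {xs = elements p}

  -- A list of exactly `suc (rank v)` elements, none with a larger `d` than `v`: the witness for
  -- every estimate on the element of a given rank.
  upTo : Fin n → List (Fin n)
  upTo v = v ∷ below v

  upTo-unique : ∀ v → Unique (upTo v)
  upTo-unique v = All.map (λ u<v → λ { refl → <-irrefl refl u<v })
                          (All.all-filter (λ u → key u <? key v) (elements p))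
                ∷ Unique.filter⁺ (λ u → key u <? key v) (elements-unique p)

  upTo-⊆ : ∀ {v} → v ∈ p → upTo v ⊆ₗ elements p
  upTo-⊆ v∈p (here refl) = ∈-elements⁺ v∈p
  upTo-⊆ v∈p (there u∈)  = proj₁ (∈-below⁻ u∈)

  upTo-≤ : ∀ {u v} → u ∈ₗ upTo v → d u ≤ d v
  upTo-≤ (here refl) = ≤-refl
  upTo-≤ (there u∈)  = key-cancel-≤ (<⇒≤ (proj₂ (∈-below⁻ u∈)))

  rank<∣p∣ : ∀ {v} → v ∈ p → rank v < ∣ p ∣
  rank<∣p∣ {v} v∈p = subst (rank v <_) (length-elements p) (length-⊆ (upTo-unique _) (upTo-⊆ v∈p))

  rank-mono : ∀ {u v} → u ∈ p → key u < key v → rank u < rank v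
  rank-mono {u} {v} u∈p ku<kv = length-⊆ (upTo-unique u) λ where
    (here refl) → ∈-filter⁺ (λ z → key z <? key v) (∈-elements⁺ u∈p) ku<kv
    (there z∈)  → let z∈p , kz<ku = ∈-below⁻ z∈
                  in  ∈-filter⁺ (λ z → key z <? key v) z∈p (<-trans kz<ku ku<kv)

  module _ {r : ℕ} where

    rankColour : Fin n → Fin (suc r)
    rankColour v with rank v <? suc r
    ... | yes lt = fromℕ< lt
    -- A junk colour: when `p` has `suc r` elements it arises only off `p`.
    ... | no  _  = zero

    module _ (∣p∣≡ : ∣ p ∣ ≡ suc r) where

      toℕ-rankColour : ∀ {v} → v ∈ p → toℕ (rankColour v) ≡ rank v
      toℕ-rankColour {v} v∈p with rank v <? suc r
      ... | yes lt = toℕ-fromℕ< lt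
      ... | no  ≮  = contradiction (subst (rank v <_) ∣p∣≡ (rank<∣p∣ v∈p)) ≮

      rankColour-mono : ∀ {u v} → u ∈ p → v ∈ p → key u < key v → toℕ (rankColour u) < toℕ (rankColour v)
      rankColour-mono u∈p v∈p ku<kv =
        subst₂ _<_ (sym (toℕ-rankColour u∈p)) (sym (toℕ-rankColour v∈p)) (rank-mono u∈p ku<kv)

      rankColour-injective : InjectiveOn p rankColour
      rankColour-injective {u} {v} u∈p v∈p eq with <-cmp (key u) (key v)
      ... | tri< lt _ _ = contradiction (cong toℕ eq) (<⇒≢ (rankColour-mono u∈p v∈p lt))
      ... | tri≈ _ ≡ _  = key-injective ≡
      ... | tri> _ _ gt = contradiction (cong toℕ (sym eq)) (<⇒≢ (rankColour-mono v∈p u∈p gt))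

length-filter-split : {P : A → Set} (P? : Decidable P) (xs : List A) →
                      length xs ≡ length (filter P? xs) + length (filter (¬? ∘ P?) xs)
length-filter-split P? []       = refl
length-filter-split P? (x ∷ xs) with P? x
... | yes _ = cong suc (length-filter-split P? xs)
... | no  _ = trans (cong suc (length-filter-split P? xs)) (sym (+-suc _ _))

-- A colouring that agrees with many prescribed ones.

module _ {r : ℕ} where

  δ : Bool → Fin (suc r) → Fin (suc r) → ℕ
  δ inside  c d = 𝟙 (c ≟ d)
  δ outside c d = 1

  -- The 0/1 indicator that `χ` and `ρ` coincide on `p`, as a product over the vertices, so that
  -- fixing the colour of the first vertex splits off one factor.
  agreement : Subset n → (χ ρ : Fin n → Fin (suc r)) → ℕ
  agreement []      χ ρ = 1
  agreement (b ∷ p) χ ρ = δ b (χ zero) (ρ zero) * agreement p (χ ∘ suc) (ρ ∘ suc)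

  agreement≤1 : ∀ (p : Subset n) χ ρ → agreement p χ ρ ≤ 1
  agreement≤1 []            χ ρ = ≤-refl
  agreement≤1 (outside ∷ p) χ ρ = ≤-trans (≤-reflexive (+-identityʳ _)) (agreement≤1 p _ _)
  agreement≤1 (inside  ∷ p) χ ρ with χ zero ≟ ρ zero
  ... | yes _ = ≤-trans (≤-reflexive (+-identityʳ _)) (agreement≤1 p _ _)
  ... | no  _ = z≤n

  agreement-sound : ∀ (p : Subset n) χ ρ → 1 ≤ agreement p χ ρ → ∀ {v} → v ∈ p → χ v ≡ ρ v
  agreement-sound (outside ∷ p) χ ρ 1≤ (there v∈) =
    agreement-sound p _ _ (≤-trans 1≤ (≤-reflexive (+-identityʳ _))) v∈
  agreement-sound (inside  ∷ p) χ ρ 1≤ v∈ with χ zero ≟ ρ zero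
  agreement-sound (inside  ∷ p) χ ρ 1≤ here       | yes eq = eq
  agreement-sound (inside  ∷ p) χ ρ 1≤ (there v∈) | yes _  =
    agreement-sound p _ _ (≤-trans 1≤ (≤-reflexive (+-identityʳ _))) v∈
  agreement-sound (inside  ∷ p) χ ρ () v∈         | no _

  -- The number of colourings that take prescribed values on `p`, one factor `suc r` for each vertex
  -- outside `p`. Divided by `suc r ^ n` it is the probability that a random colouring agrees with
  -- `ρ` on `p`.
  freedom : Subset n → ℕ
  freedom []            = 1
  freedom (outside ∷ p) = suc r * freedom p
  freedom (inside  ∷ p) = freedom p

  freedom-* : (p : Subset n) → freedom p * suc r ^ ∣ p ∣ ≡ suc r ^ n
  freedom-* []            = refl
  freedom-* (outside ∷ p) = trans (*-assoc (suc r) (freedom p) _) (cong (suc r *_) (freedom-* p))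
  freedom-* (inside  ∷ p) = trans (x∙yz≈y∙xz (freedom p) (suc r) _) (cong (suc r *_) (freedom-* p))

  -- Method of conditional expectations: the vertices are coloured one by one,
  -- and w records the edges which agree with the choices made so far.
  colouring-exists : ∀ {I : Set} (L : List I) (w : I → ℕ) (E : I → Subset n) (ρ : I → Fin n → Fin (suc r)) →
    ∃[ χ ] ∑[ i ← L ] (w i * freedom (E i)) ≤ suc r ^ n * ∑[ i ← L ] (w i * agreement (E i) χ (ρ i))
  colouring-exists {zero} L w E ρ = χ , ≤-reflexive (trans
    (∑-cong L λ {i} _ → cong (w i *_) (same (E i) χ (ρ i)))
    (sym (*-identityˡ _)))
    where
    χ : Fin 0 → Fin (suc r)
    χ ()
    same : ∀ (p : Subset 0) χ ρ → freedom p ≡ agreement p χ ρ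
    same [] χ ρ = refl
  colouring-exists {suc n} L w E ρ = χ , (begin
    ∑[ i ← L ] (w i * freedom (E i))                        ≤⟨ ∑-mono L (λ {i} _ → split (w i) (E i) (ρ i zero)) ⟩
    ∑[ i ← L ] ∑[ c ← allFin (suc r) ] term c i             ≡⟨ ∑-swap L (allFin (suc r)) (λ i c → term c i) ⟩
    ∑[ c ← allFin (suc r) ] ∑[ i ← L ] term c i             ≤⟨ proj₂ best ⟩
    length (allFin (suc r)) * ∑[ i ← L ] term c i           ≡⟨ cong (_* ∑[ i ← L ] term c i) ∣allFin∣ ⟩
    suc r * ∑[ i ← L ] term c i                             ≤⟨ *-monoʳ-≤ (suc r) (proj₂ (rest c)) ⟩
    suc r * (suc r ^ n * ∑[ i ← L ] (w′ c i * agreement (Vec.tail (E i)) (proj₁ (rest c)) (ρ i ∘ suc)))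
      ≡⟨ cong (λ x → suc r * (suc r ^ n * x)) (∑-cong L λ {i} _ → join (w i) (E i) (ρ i)) ⟩
    suc r * (suc r ^ n * ∑[ i ← L ] (w i * agreement (E i) χ (ρ i))) ≡⟨ *-assoc (suc r) (suc r ^ n) _ ⟨
    suc r * suc r ^ n * ∑[ i ← L ] (w i * agreement (E i) χ (ρ i)) ∎)
    where
    open ≤-Reasoning
    ∣allFin∣ : length (allFin (suc r)) ≡ suc r
    ∣allFin∣ = length-tabulate {n = suc r} id
    w′ : Fin (suc r) → _ → ℕ
    w′ c i = w i * δ (Vec.head (E i)) c (ρ i zero)
    term : Fin (suc r) → _ → ℕ
    term c i = w′ c i * freedom (Vec.tail (E i))
    rest : ∀ c → _
    rest c = colouring-exists L (w′ c) (Vec.tail ∘ E) (λ i → ρ i ∘ suc)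
    best = max-≥-average (λ c → ∑[ i ← L ] term c i) zero (tabulate suc)
    c = proj₁ best
    χ : Fin (suc n) → Fin (suc r)
    χ zero    = c
    χ (suc v) = proj₁ (rest c) v
    split : ∀ k (p : Subset (suc n)) d →
            k * freedom p ≤ ∑[ c ← allFin (suc r) ] (k * δ (Vec.head p) c d * freedom (Vec.tail p))
    split k (outside ∷ p) d = ≤-reflexive (begin-equality
      k * (suc r * freedom p)                         ≡⟨ x∙yz≈y∙xz k (suc r) (freedom p) ⟩
      suc r * (k * freedom p)                         ≡⟨ cong₂ _*_ ∣allFin∣ (cong (_* freedom p) (*-identityʳ k)) ⟨
      length (allFin (suc r)) * (k * 1 * freedom p)   ≡⟨ ∑-const (allFin (suc r)) _ ⟨
      ∑[ _ ← allFin (suc r) ] (k * 1 * freedom p)     ∎)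
    split k (inside  ∷ p) d = begin
      k * freedom p                ≡⟨ cong (_* freedom p) (*-identityʳ k) ⟨
      k * 1 * freedom p            ≡⟨ cong (λ x → k * x * freedom p) (𝟙-true (d ≟ d) refl) ⟨
      k * 𝟙 (d ≟ d) * freedom p    ≤⟨ ∈⇒≤∑ (λ c → k * 𝟙 (c ≟ d) * freedom p) (∈-allFin d) ⟩
      ∑[ c ← allFin (suc r) ] (k * 𝟙 (c ≟ d) * freedom p) ∎
    join : ∀ k (p : Subset (suc n)) ρ →
           k * δ (Vec.head p) c (ρ zero) * agreement (Vec.tail p) (proj₁ (rest c)) (ρ ∘ suc) ≡ k * agreement p χ ρ
    join k (b ∷ p) ρ = *-assoc k _ _

  agreeing : (χ : Fin n → Fin (suc r)) (ρ : Subset n → Fin n → Fin (suc r)) →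
             List (Subset n) → List (Subset n)
  agreeing χ ρ = filter (λ p → 1 ≤? agreement p χ (ρ p))

  -- A random colouring agrees on a given set of size `suc r` with probability 1/`Q`, so some
  -- colouring does at least as well as this expectation. Scaling by `Q` avoids forming the exponent
  -- `n` minus `suc r`.
  uniform-colouring : (L : List (Subset n)) → (∀ {p} → p ∈ₗ L → ∣ p ∣ ≡ suc r) →
    (ρ : Subset n → Fin n → Fin (suc r)) → ∃[ χ ] length L ≤ suc r ^ suc r * length (agreeing χ ρ L)
  uniform-colouring {n} L unif ρ with colouring-exists L (λ _ → 1) id ρ
  ... | χ , le = χ , *-cancelˡ-≤ (suc r ^ n) {{m^n≢0 (suc r) n}} (begin
    suc r ^ n * length L                                      ≡⟨ *-comm _ (length L) ⟩
    length L * suc r ^ n                                      ≡⟨ ∑-const L _ ⟨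
    ∑[ _ ← L ] (suc r ^ n)                                    ≡⟨ ∑-cong L (λ {p} p∈L → freedom-uniform p (unif p∈L)) ⟩
    ∑[ p ← L ] (Q * (1 * freedom p))                          ≡⟨ ∑-*ˡ L Q (λ p → 1 * freedom p) ⟩
    Q * ∑[ p ← L ] (1 * freedom p)                            ≤⟨ *-monoʳ-≤ Q le ⟩
    Q * (suc r ^ n * ∑[ p ← L ] (1 * agreement p χ (ρ p)))    ≤⟨ *-monoʳ-≤ Q (*-monoʳ-≤ (suc r ^ n) count) ⟩
    Q * (suc r ^ n * length (agreeing χ ρ L))                 ≡⟨ x∙yz≈y∙xz Q (suc r ^ n) _ ⟩
    suc r ^ n * (Q * length (agreeing χ ρ L))                 ∎)
    where
    open ≤-Reasoning
    Q = suc r ^ suc r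
    freedom-uniform : ∀ p → ∣ p ∣ ≡ suc r → suc r ^ n ≡ Q * (1 * freedom p)
    freedom-uniform p ∣p∣≡ = begin-equality
      suc r ^ n                 ≡⟨ freedom-* p ⟨
      freedom p * suc r ^ ∣ p ∣ ≡⟨ cong (λ k → freedom p * suc r ^ k) ∣p∣≡ ⟩
      freedom p * Q             ≡⟨ *-comm (freedom p) Q ⟩
      Q * freedom p             ≡⟨ cong (Q *_) (+-identityʳ (freedom p)) ⟨
      Q * (1 * freedom p)       ∎
    ≤𝟙 : ∀ k → k ≤ 1 → 1 * k ≤ 𝟙 (1 ≤? k)
    ≤𝟙 zero       _ = z≤n
    ≤𝟙 (suc zero) _ = ≤-refl
    ≤𝟙 (suc (suc _)) (s≤s ())
    count : ∑[ p ← L ] (1 * agreement p χ (ρ p)) ≤ length (agreeing χ ρ L)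
    count = begin
      ∑[ p ← L ] (1 * agreement p χ (ρ p))          ≤⟨ ∑-mono L (λ {p} _ → ≤𝟙 _ (agreement≤1 p χ (ρ p))) ⟩
      ∑[ p ← L ] 𝟙 (1 ≤? agreement p χ (ρ p))       ≡⟨ length-filter≡∑ (λ p → 1 ≤? agreement p χ (ρ p)) L ⟨
      length (agreeing χ ρ L)                       ∎

-- Subfamilies with large positive codegrees.

degree : List (Subset n) → Subset n → ℕ
degree L S = length (filter (S ⊆?_) L)

_≟ₛ_ : (p q : Subset n) → Dec (p ≡ q)
_≟ₛ_ = Vec.≡-dec Bool._≟_

-- Here and in what is built on it, `c` is one less than the parameter of the theorem, so the strict
-- inequality says that positive codegrees are at least that parameter.
record Dense (c : ℕ) (H : List (Subset n)) : Set where
  field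
    nonempty : ∃[ p ] p ∈ₗ H
    unique   : Unique H
    codegree : ∀ {p v} → p ∈ₗ H → v ∈ p → c < degree H (p - v)

-- Delete all sets through a facet `S` of codegree at most `c`, and delete `S` from the list `P` of
-- possible facets. Each round costs at most `c` sets and exhausts a facet for good, so
-- `c * length P < length H` persists; the fuel bounds the length of `P`.
dense-subgraph : ∀ c (H P : List (Subset n)) → Unique H →
  (∀ {p v} → p ∈ₗ H → v ∈ p → p - v ∈ₗ P) → c * length P < length H →
  ∃[ H′ ] H′ ⊆ₗ H × Dense c H′
dense-subgraph {n} c H P = go (suc (length P)) H P ≤-refl
  where
  go : ∀ k (H P : List (Subset n)) → length P < k → Unique H →
       (∀ {p v} → p ∈ₗ H → v ∈ p → p - v ∈ₗ P) → c * length P < length H →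
       ∃[ H′ ] H′ ⊆ₗ H × Dense c H′
  go zero    H P () _ _ _
  -- The strict inequality fails for an empty family, so the deletions never use up all sets.
  go (suc k) []          P _       uH cover ()
  go (suc k) H@(p₀ ∷ _) P (s≤s P≤k) uH cover large
    with any? (λ p → any?ᶠ λ v → (v ∈? p) ×-dec (degree H (p - v) ≤? c)) H
  ... | no  none = H , id , record
    { nonempty = p₀ , here refl
    ; unique   = uH
    ; codegree = λ p∈H v∈p → ≰⇒> λ deg≤c → none (lose p∈H (_ , v∈p , deg≤c)) }
  ... | yes some with find some
  ... | p , p∈H , v , v∈p , deg≤c =
    let H′ , H′⊆ , dense = go k H₁ P₁ (<-≤-trans P₁<P P≤k) (Unique.filter⁺ (¬? ∘ (S ⊆?_)) uH) cover₁ large₁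
    in  H′ , proj₁ ∘ ∈-filter⁻ (¬? ∘ (S ⊆?_)) ∘ H′⊆ , dense
    where
    S = p - v
    H₁ = filter (¬? ∘ (S ⊆?_)) H
    P₁ = filter (λ q → ¬? (q ≟ₛ S)) P
    P₁<P : length P₁ < length P
    P₁<P = filter-notAll (λ q → ¬? (q ≟ₛ S)) P (lose (cover p∈H v∈p) λ S≢S → S≢S refl)
    cover₁ : ∀ {q u} → q ∈ₗ H₁ → u ∈ q → q - u ∈ₗ P₁
    cover₁ q∈ u∈q with ∈-filter⁻ (¬? ∘ (S ⊆?_)) q∈
    ... | q∈H , S⊈q = ∈-filter⁺ (λ q → ¬? (q ≟ₛ S)) (cover q∈H u∈q) λ eq → S⊈q (subst (_⊆ _) eq p-x⊆p)
    large₁ : c * length P₁ < length H₁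
    large₁ = +-cancelˡ-< c _ _ (begin-strict
      c + c * length P₁                      ≡⟨ *-suc c (length P₁) ⟨
      c * suc (length P₁)                    ≤⟨ *-monoʳ-≤ c P₁<P ⟩
      c * length P                           <⟨ large ⟩
      length H                               ≡⟨ length-filter-split (S ⊆?_) H ⟩
      degree H S + length H₁                 ≤⟨ +-monoˡ-≤ (length H₁) deg≤c ⟩
      c + length H₁                          ∎)
      where open ≤-Reasoning

-- Weights of facets and light edges.

∈-subsets : (p : Subset n) → p ∈ₗ subsets n
∈-subsets []            = here refl
∈-subsets (outside ∷ p) = ∈-++⁺ˡ (∈-map⁺ (outside ∷_) (∈-subsets p))
∈-subsets (inside  ∷ p) = ∈-++⁺ʳ _ (∈-map⁺ (inside ∷_) (∈-subsets p))

-- The junk value at 0 makes the quotient antitone in the divisor everywhere.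
quotient : ℕ → ℕ → ℕ
quotient M zero    = M
quotient M (suc d) = M / suc d

quotient-antitone : ∀ M {d d′} → d ≤ d′ → quotient M d′ ≤ quotient M d
quotient-antitone M {zero}  {zero}   _    = ≤-refl
quotient-antitone M {zero}  {suc d′} _    = m/n≤m M (suc d′)
quotient-antitone M {suc d} {suc d′} d≤d′ = /-monoʳ-≤ M d≤d′

quotient-! : ∀ {d k} → 1 ≤ d → d ≤ k → quotient (k !) d * d ≡ k !
quotient-! {suc d} {k} _ d≤k = m/n*n≡m (∣-trans (m∣m*n (d !)) (m≤n⇒m!∣n! d≤k))

module _ {r n : ℕ} (G : RGraph (suc r) n) (N : ℕ) where

  -- Scaling the weights 1/d(S) by M makes them integers.
  M : ℕ
  M = e G !

  instance
    M≢0 : NonZero M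
    M≢0 = e G !≢0

  w : Subset n → ℕ
  w S = quotient M (degree (edges G) S)

  weight : Subset n → ℕ
  weight p = ∑[ v ← elements p ] w (p - v)

  -- A facet of an edge has degree between 1 and `e G`, and such a number divides `M`.
  w*degree : ∀ {p S} → p ∈ₗ edges G → S ⊆ p → w S * degree (edges G) S ≡ M
  w*degree p∈G S⊆p = quotient-!
    (length-⊆ {xs = _ ∷ []} ([] ∷ []) λ { (here refl) → ∈-filter⁺ (_ ⊆?_) p∈G S⊆p })
    (length-filter (_ ⊆?_) (edges G))

  ∂-facet : ∀ {p v} → p ∈ₗ edges G → v ∈ p → p - v ∈ₗ edges (∂ G)
  ∂-facet {p} {v} p∈G v∈p = ∈-filter⁺ (inShadow? G) (∈-subsets (p - v))
    ( cong pred (trans (sym (x∈p⇒∣p∣≡1+∣p-x∣ v∈p)) (All.lookup (uniform G) p∈G))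
    , lose p∈G p-x⊆p )

  total-weight : ∑[ p ← edges G ] weight p ≤ e (∂ G) * M
  total-weight = begin
    ∑[ p ← edges G ] weight p                                        ≤⟨ ∑-mono (edges G) through-∂ ⟩
    ∑[ p ← edges G ] ∑[ S ← edges (∂ G) ] (w S * 𝟙 (S ⊆? p))
      ≡⟨ ∑-swap (edges G) (edges (∂ G)) (λ p S → w S * 𝟙 (S ⊆? p)) ⟩
    ∑[ S ← edges (∂ G) ] ∑[ p ← edges G ] (w S * 𝟙 (S ⊆? p))         ≡⟨ ∑-cong (edges (∂ G)) collect ⟩
    ∑[ S ← edges (∂ G) ] M                                           ≡⟨ ∑-const (edges (∂ G)) M ⟩
    e (∂ G) * M                                                      ∎
    where
    open ≤-Reasoning
    through-∂ : ∀ {p} → p ∈ₗ edges G → weight p ≤ ∑[ S ← edges (∂ G) ] (w S * 𝟙 (S ⊆? p))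
    through-∂ {p} p∈G = begin
      ∑[ v ← elements p ] w (p - v)                   ≡⟨ cong sum (map-∘ (elements p)) ⟩
      ∑ (map (p -_) (elements p)) w                   ≤⟨ ∑-⊆ w (injectiveOn-unique distinct) facets ⟩
      ∑ (filter (_⊆? p) (edges (∂ G))) w              ≡⟨ ∑-filter (_⊆? p) (edges (∂ G)) w ⟩
      ∑[ S ← edges (∂ G) ] (w S * 𝟙 (S ⊆? p))         ∎
      where
      distinct : InjectiveOn p (p -_)
      distinct {x} {y} x∈p y∈p eq = decidable-stable (x ≟ y) λ x≢y →
        x∉p-x (subst (x ∈_) (sym eq) (x∈p∧x≢y⇒x∈p-y x∈p x≢y))
      facets : map (p -_) (elements p) ⊆ₗ filter (_⊆? p) (edges (∂ G))
      facets S∈ with ∈-map⁻ (p -_) S∈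
      ... | v , v∈ , refl = ∈-filter⁺ (_⊆? p) (∂-facet p∈G (∈-elements⁻ v∈)) p-x⊆p
    collect : ∀ {S} → S ∈ₗ edges (∂ G) → ∑[ p ← edges G ] (w S * 𝟙 (S ⊆? p)) ≡ M
    collect {S} S∈ with find (proj₂ (proj₂ (∈-filter⁻ (inShadow? G) {xs = subsets n} S∈)))
    ... | p , p∈G , S⊆p = begin-equality
      ∑[ p ← edges G ] (w S * 𝟙 (S ⊆? p))      ≡⟨ ∑-*ˡ (edges G) (w S) (λ p → 𝟙 (S ⊆? p)) ⟩
      w S * ∑[ p ← edges G ] 𝟙 (S ⊆? p)        ≡⟨ cong (w S *_) (length-filter≡∑ (S ⊆?_) (edges G)) ⟨
      w S * degree (edges G) S                 ≡⟨ w*degree p∈G S⊆p ⟩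
      M                                        ∎

  -- Cleared of denominators: `weight p` is scaled by `M`, and for `N` = 0 every edge is light.
  Light : Subset n → Set
  Light p = N * weight p < suc r * M

  light? : ∀ p → Dec (Light p)
  light? p = N * weight p <? suc r * M

  -- Each heavy edge takes weight at least `suc r` / `N`, before scaling, out of a total of at most
  -- `e (∂ G)`.
  few-heavy : length (filter (¬? ∘ light?) (edges G)) * suc r ≤ N * e (∂ G)
  few-heavy = *-cancelʳ-≤ _ _ M (begin
    length heavy * suc r * M        ≡⟨ *-assoc (length heavy) (suc r) M ⟩
    length heavy * (suc r * M)      ≡⟨ ∑-const heavy _ ⟨
    ∑[ _ ← heavy ] (suc r * M)      ≤⟨ ∑-mono heavy (λ p∈ → ≮⇒≥ (proj₂ (∈heavy⁻ p∈))) ⟩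
    ∑[ p ← heavy ] (N * weight p)   ≡⟨ ∑-*ˡ heavy N weight ⟩
    N * ∑ heavy weight              ≤⟨ *-monoʳ-≤ N (∑-⊆ weight (Unique.filter⁺ (¬? ∘ light?) (unique G))
                                         (proj₁ ∘ ∈heavy⁻)) ⟩
    N * ∑ (edges G) weight          ≤⟨ *-monoʳ-≤ N total-weight ⟩
    N * (e (∂ G) * M)               ≡⟨ *-assoc N (e (∂ G)) M ⟨
    N * e (∂ G) * M                 ∎)
    where
    open ≤-Reasoning
    heavy = filter (¬? ∘ light?) (edges G)
    ∈heavy⁻ : ∀ {p} → p ∈ₗ heavy → p ∈ₗ edges G × ¬ Light p
    ∈heavy⁻ = ∈-filter⁻ (¬? ∘ light?) {xs = edges G}

  module ByDegree (p : Subset n) = Rank p (λ u → degree (edges G) (p - u))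

  -- A facet of rank i comes after i facets of no smaller weight.
  light-degree : ∀ {p v} → p ∈ₗ edges G → Light p → v ∈ p →
                 N * suc (ByDegree.rank p v) < suc r * degree (edges G) (p - v)
  light-degree {p} {v} p∈G light v∈p = *-cancelʳ-< _ _ _ (begin-strict
    N * suc (rank v) * w (p - v)         ≡⟨ *-assoc N _ _ ⟩
    N * (suc (rank v) * w (p - v))       ≡⟨ cong (N *_) (∑-const (upTo v) (w (p - v))) ⟨
    N * ∑[ _ ← upTo v ] w (p - v)        ≤⟨ *-monoʳ-≤ N (∑-mono (upTo v) (λ u∈ → quotient-antitone M (upTo-≤ u∈))) ⟩
    N * ∑[ u ← upTo v ] w (p - u)        ≤⟨ *-monoʳ-≤ N (∑-⊆ (λ u → w (p - u)) (upTo-unique v) (upTo-⊆ v∈p)) ⟩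
    N * weight p                         <⟨ light ⟩
    suc r * M                            ≡⟨ cong (suc r *_) (trans (*-comm d _) (w*degree p∈G p-x⊆p)) ⟨
    suc r * (d * w (p - v))              ≡⟨ *-assoc (suc r) d _ ⟨
    suc r * d * w (p - v)                ∎)
    where
    open ≤-Reasoning
    open ByDegree p
    d = degree (edges G) (p - v)

-- The coloured subgraph that receives the trunk.

-- What the embedding relies on. Codegrees in `dense` are counted in `H`, where the trunk is placed;
-- degrees in `rich` are counted in all of `G`, where the leaf edges go, and their bound depends
-- only on the colour of the opposite vertex.
record Graded {r n} (G : RGraph (suc r) n) (N c : ℕ) : Set where
  field
    χ       : Fin n → Fin (suc r)
    H       : List (Subset n)
    H⊆G     : H ⊆ₗ edges G
    dense   : Dense c H
    rainbow : ∀ {p} → p ∈ₗ H → InjectiveOn p χ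
    rich    : ∀ {p v} → p ∈ₗ H → v ∈ p → N * suc (toℕ (χ v)) < suc r * degree (edges G) (p - v)

-- Discarding the heavy edges leaves more than `Q * (c * s)` light ones. The colouring retains at
-- least a fraction 1/`Q` of them, so more than `c * s`, which is what `dense-subgraph` asks for
-- when the shadow serves as `P`.
graded-subgraph : ∀ {r n} (G : RGraph (suc r) n) (N c : ℕ) →
  (N + suc r * (suc r ^ suc r * c)) * e (∂ G) < e G * suc r → Graded G N c
graded-subgraph {r} {n} G N c large = record
  { χ       = χ
  ; H       = H
  ; H⊆G     = proj₁ ∘ ∈L ∘ proj₁ ∘ ∈A ∘ H⊆A
  ; dense   = dense
  ; rainbow = λ {p} p∈H x∈p y∈p χx≡χy → ByDegree.rankColour-injective G N p (∣p∣≡ p∈H) x∈p y∈p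
                (trans (sym (χ≡ p∈H x∈p)) (trans χx≡χy (χ≡ p∈H y∈p)))
  ; rich    = λ {p} {v} p∈H v∈p → let p∈G , light = ∈L (proj₁ (∈A (H⊆A p∈H))) in
      subst (λ i → N * suc i < suc r * degree (edges G) (p - v))
            (sym (trans (cong toℕ (χ≡ p∈H v∈p)) (ByDegree.toℕ-rankColour G N p (∣p∣≡ p∈H) v∈p)))
            (light-degree G N p∈G light v∈p)
  }
  where
  open ≤-Reasoning
  s = e (∂ G)
  ρ : Subset n → Fin n → Fin (suc r)
  ρ p = ByDegree.rankColour G N p
  Q = suc r ^ suc r
  L = filter (light? G N) (edges G)
  ∈L : ∀ {p} → p ∈ₗ L → p ∈ₗ edges G × Light G N p
  ∈L = ∈-filter⁻ (light? G N)
  many-light : Q * (c * s) < length L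
  many-light = *-cancelˡ-< (suc r) _ _ (+-cancelˡ-< (N * s) _ _ (begin-strict
    N * s + suc r * (Q * (c * s))      ≡⟨ cong (λ x → N * s + suc r * x) (*-assoc Q c s) ⟨
    N * s + suc r * (Q * c * s)        ≡⟨ cong (N * s +_) (*-assoc (suc r) (Q * c) s) ⟨
    N * s + suc r * (Q * c) * s        ≡⟨ *-distribʳ-+ s N _ ⟨
    (N + suc r * (Q * c)) * s          <⟨ large ⟩
    e G * suc r                        ≡⟨ cong (_* suc r) (length-filter-split (light? G N) (edges G)) ⟩
    (length L + b) * suc r             ≡⟨ cong (_* suc r) (+-comm (length L) b) ⟩
    (b + length L) * suc r             ≡⟨ *-distribʳ-+ (suc r) b (length L) ⟩
    b * suc r + length L * suc r       ≤⟨ +-mono-≤ (few-heavy G N) (≤-reflexive (*-comm (length L) (suc r))) ⟩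
    N * s + suc r * length L           ∎))
    where b = length (filter (¬? ∘ light? G N) (edges G))
  coloured = uniform-colouring L (All.lookup (uniform G) ∘ proj₁ ∘ ∈L) ρ
  χ = proj₁ coloured
  agreed = agreeing χ ρ L
  ∈A : ∀ {p} → p ∈ₗ agreed → p ∈ₗ L × 1 ≤ agreement p χ (ρ p)
  ∈A = ∈-filter⁻ (λ p → 1 ≤? agreement p χ (ρ p))
  denser = dense-subgraph c agreed (edges (∂ G))
    (Unique.filter⁺ (λ p → 1 ≤? agreement p χ (ρ p)) (Unique.filter⁺ (light? G N) (unique G)))
    (λ p∈A → ∂-facet G N (proj₁ (∈L (proj₁ (∈A p∈A)))))
    (*-cancelˡ-< Q _ _ (<-≤-trans many-light (proj₂ coloured)))
  H     = proj₁ denser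
  H⊆A   = proj₁ (proj₂ denser)
  dense = proj₂ (proj₂ denser)
  ∣p∣≡ : ∀ {p} → p ∈ₗ H → ∣ p ∣ ≡ suc r
  ∣p∣≡ = All.lookup (uniform G) ∘ proj₁ ∘ ∈L ∘ proj₁ ∘ ∈A ∘ H⊆A
  χ≡ : ∀ {p v} → p ∈ₗ H → v ∈ p → χ v ≡ ρ p v
  χ≡ {p} p∈H = agreement-sound p χ (ρ p) (proj₂ (∈A (H⊆A p∈H)))

-- Balanced colour classes and rainbow sets.

module _ {r : ℕ} where

  -- Rank the colours by the size of their class.
  colour-order : (cs : List (Fin (suc r))) →
    ∃[ σ ] InjectiveOn ⊤ σ × (∀ j →
      suc r * length (filter (λ c → toℕ (σ c) ≤? toℕ (σ j)) cs) ≤ suc (toℕ {suc r} (σ j)) * length cs)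
  colour-order cs = rankColour , rankColour-injective ∣⊤∣≡ , bound
    where
    class : Fin (suc r) → ℕ
    class j = length (filter (_≟ j) cs)
    ∣⊤∣≡ = ∣⊤∣≡n (suc r)
    open Rank {suc r} ⊤ class
    module _ (j : Fin (suc r)) where
      open ≤-Reasoning
      all = elements {suc r} ⊤
      K? : Decidable (λ i → key i ≤ key j)
      K? i = key i ≤? key j
      lower = filter K? all
      upper = filter (¬? ∘ K?) all
      σ-cancel-≤ : ∀ {c} → toℕ (rankColour {r} c) ≤ toℕ (rankColour {r} j) → key c ≤ key j
      σ-cancel-≤ σc≤σj = ≮⇒≥ λ kj<kc → <⇒≱ (rankColour-mono ∣⊤∣≡ ∈⊤ ∈⊤ kj<kc) σc≤σj
      𝟙-mono : ∀ {P : Set} (P? : Dec P) {k} → (P → 1 ≤ k) → 𝟙 P? ≤ k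
      𝟙-mono (yes p) h = h p
      𝟙-mono (no _)  _ = z≤n
      count-lower : length (filter (λ c → toℕ (rankColour {r} c) ≤? toℕ (rankColour {r} j)) cs) ≤ ∑ lower class
      count-lower = begin
        length (filter (λ c → toℕ (rankColour {r} c) ≤? toℕ (rankColour {r} j)) cs)
          ≡⟨ length-filter≡∑ (λ c → toℕ (rankColour {r} c) ≤? toℕ (rankColour {r} j)) cs ⟩
        ∑[ c ← cs ] 𝟙 (toℕ (rankColour {r} c) ≤? toℕ (rankColour {r} j))
          ≤⟨ ∑-mono cs (λ {c} _ → 𝟙-mono (_ ≤? _) λ le → ≤-trans
               (≤-reflexive (sym (𝟙-true (c ≟ c) refl)))
               (∈⇒≤∑ (λ i → 𝟙 (c ≟ i)) (∈-filter⁺ K? (∈-elements⁺ ∈⊤) (σ-cancel-≤ le)))) ⟩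
        ∑[ c ← cs ] ∑[ i ← lower ] 𝟙 (c ≟ i)  ≡⟨ ∑-swap cs lower (λ c i → 𝟙 (c ≟ i)) ⟩
        ∑[ i ← lower ] ∑[ c ← cs ] 𝟙 (c ≟ i)  ≡⟨ ∑-cong lower (λ {i} _ → length-filter≡∑ (_≟ i) cs) ⟨
        ∑ lower class                         ∎
      total : ∑ lower class + ∑ upper class ≤ length cs
      total = begin
        ∑ lower class + ∑ upper class            ≡⟨ cong₂ _+_ (∑-filter K? all class) (∑-filter (¬? ∘ K?) all class) ⟩
        ∑[ i ← all ] (class i * 𝟙 (K? i)) + ∑[ i ← all ] (class i * 𝟙 (¬? (K? i)))
          ≡⟨ ∑-+ all (λ i → class i * 𝟙 (K? i)) (λ i → class i * 𝟙 (¬? (K? i))) ⟨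
        ∑[ i ← all ] (class i * 𝟙 (K? i) + class i * 𝟙 (¬? (K? i)))
          ≡⟨ ∑-cong all (λ {i} _ → split (class i) (K? i)) ⟩
        ∑[ i ← all ] class i                     ≡⟨ ∑-cong all (λ {i} _ → length-filter≡∑ (_≟ i) cs) ⟩
        ∑[ i ← all ] ∑[ c ← cs ] 𝟙 (c ≟ i)       ≡⟨ ∑-swap all cs (λ i c → 𝟙 (c ≟ i)) ⟩
        ∑[ c ← cs ] ∑[ i ← all ] 𝟙 (c ≟ i)       ≤⟨ ∑-mono cs (λ {c} _ → once c) ⟩
        ∑[ c ← cs ] 1                            ≡⟨ length≡∑ cs ⟨
        length cs                                ∎
        where
        split : ∀ k {P : Set} (P? : Dec P) → k * 𝟙 P? + k * 𝟙 (¬? P?) ≡ k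
        split k (yes _) = trans (cong₂ _+_ (*-identityʳ k) (*-zeroʳ k)) (+-identityʳ k)
        split k (no  _) = cong₂ _+_ (*-zeroʳ k) (*-identityʳ k)
        once : ∀ c → ∑[ i ← all ] 𝟙 (c ≟ i) ≤ 1
        once c = begin
          ∑[ i ← all ] 𝟙 (c ≟ i)       ≡⟨ length-filter≡∑ (c ≟_) all ⟨
          length (filter (c ≟_) all)   ≤⟨ length-⊆ {ys = c ∷ []} (Unique.filter⁺ (c ≟_) (elements-unique ⊤))
                                            (λ i∈ → here (sym (proj₂ (∈-filter⁻ (c ≟_) {xs = all} i∈)))) ⟩
          length (c ∷ [])              ∎
      ∣lower∣ : length lower ≤ suc (rank j)
      ∣lower∣ = length-⊆ {ys = upTo j} (Unique.filter⁺ K? (elements-unique ⊤))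
                         λ {i} i∈ → lower⊆ i (∈-filter⁻ K? {xs = all} i∈)
        where
        lower⊆ : ∀ i → i ∈ₗ all × key i ≤ key j → i ∈ₗ upTo j
        lower⊆ i (i∈ , ki≤kj) with i ≟ j
        ... | yes refl = here refl
        ... | no  i≢j  = there (∈-filter⁺ (λ u → key u <? key j) i∈ (≤∧≢⇒< ki≤kj (i≢j ∘ key-injective)))
      bound : suc r * length (filter (λ c → toℕ (rankColour {r} c) ≤? toℕ (rankColour {r} j)) cs)
              ≤ suc (toℕ (rankColour {r} j)) * length cs
      bound = begin
        suc r * length (filter (λ c → toℕ (rankColour {r} c) ≤? toℕ (rankColour {r} j)) cs)
                                                            ≤⟨ *-monoʳ-≤ (suc r) count-lower ⟩
        suc r * ∑ lower class                               ≡⟨ cong (_* ∑ lower class) ∣all∣ ⟩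
        (length lower + length upper) * ∑ lower class       ≡⟨ *-distribʳ-+ (∑ lower class) (length lower) (length upper) ⟩
        length lower * ∑ lower class + length upper * ∑ lower class
          ≤⟨ +-monoʳ-≤ (length lower * ∑ lower class) cross ⟩
        length lower * ∑ lower class + length lower * ∑ upper class ≡⟨ *-distribˡ-+ (length lower) _ _ ⟨
        length lower * (∑ lower class + ∑ upper class)      ≤⟨ *-mono-≤ ∣lower∣ total ⟩
        suc (rank j) * length cs                            ≡⟨ cong (λ k → suc k * length cs) (toℕ-rankColour ∣⊤∣≡ {j} ∈⊤) ⟨
        suc (toℕ (rankColour {r} j)) * length cs            ∎
        where
        ∣all∣ : suc r ≡ length lower + length upper
        ∣all∣ = trans (sym (trans (length-elements {suc r} ⊤) ∣⊤∣≡)) (length-filter-split K? all)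
        -- Classes in `lower` are at most `class j`, those in `upper` at least that, so the averages
        -- compare. They are cross-multiplied because `upper` may be empty.
        cross : length upper * ∑ lower class ≤ length lower * ∑ upper class
        cross = begin
          length upper * ∑ lower class             ≤⟨ *-monoʳ-≤ (length upper) (∑-mono lower λ i∈ →
                                                        key-cancel-≤ (proj₂ (∈-filter⁻ K? {xs = all} i∈))) ⟩
          length upper * ∑[ _ ← lower ] class j    ≡⟨ cong (length upper *_) (∑-const lower (class j)) ⟩
          length upper * (length lower * class j)  ≡⟨ x∙yz≈y∙xz (length upper) (length lower) (class j) ⟩
          length lower * (length upper * class j)  ≡⟨ cong (length lower *_) (∑-const upper (class j)) ⟨
          length lower * ∑[ _ ← upper ] class j    ≤⟨ *-monoʳ-≤ (length lower) (∑-mono upper λ {i} i∈ →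
                                                        key-cancel-≤ (<⇒≤ (≰⇒> (proj₂ (∈-filter⁻ (¬? ∘ K?) {xs = all} i∈))))) ⟩
          length lower * ∑ upper class             ∎

  module _ {f : Fin n → Fin (suc r)} where

    -- A missed colour together with the `suc r` distinct colours on `p` would be one colour too
    -- many.
    rainbow-surjective : ∀ {p} → ∣ p ∣ ≡ suc r → InjectiveOn p f → ∀ i → ∃[ y ] y ∈ p × f y ≡ i
    rainbow-surjective {p} ∣p∣≡ inj i with any?ᶠ (λ y → (y ∈? p) ×-dec (f y ≟ i))
    ... | yes found = found
    ... | no  none  = contradiction (length-⊆ (i-new ∷ injectiveOn-unique inj) λ {j} _ → ∈-allFin j)
                                    (<⇒≱ (≤-reflexive (cong suc (trans (length-tabulate {n = suc r} id) (sym ∣f[p]∣)))))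
      where
      i-new : All (i ≢_) (map f (elements p))
      i-new = All.map⁺ (All.tabulate λ y∈ i≡fy → none (_ , ∈-elements⁻ y∈ , sym i≡fy))
      ∣f[p]∣ : length (map f (elements p)) ≡ suc r
      ∣f[p]∣ = trans (length-map f (elements p)) (trans (length-elements p) ∣p∣≡)

    -- All other colours are used up on the common facet, so `x` and `y` both get the one left over.
    -- This carries colours across an attachment, in the trunk and in the host alike.
    exchange : ∀ {p q x y} → ∣ q ∣ ≡ suc r → InjectiveOn p f → InjectiveOn q f → x ∈ p → y ∈ q →
               p - x ≡ q - y → f x ≡ f y
    exchange {p} {q} {x} {y} ∣q∣≡ injp injq x∈p y∈q eq with rainbow-surjective ∣q∣≡ injq (f x)
    ... | z , z∈q , fz≡fx with z ≟ y
    ... | yes refl = sym fz≡fx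
    ... | no  z≢y  = contradiction (injp (p-x⊆p z∈p-x) x∈p fz≡fx) λ { refl → x∉p-x z∈p-x }
      where z∈p-x = subst (z ∈_) (sym eq) (x∈p∧x≢y⇒x∈p-y z∈q z≢y)

-- Tight orders as successive attachments.

-- Condition (*) for sets of equal size: `f - v` is then a facet of `g`, and `u` is the vertex of
-- `g` that `v` replaces. Colours and facet degrees are read off at `u`.
record Attachment (p : List (Subset m)) (f : Subset m) : Set where
  field
    v     : Fin m
    v∈f   : v ∈ f
    fresh : ∀ {g} → g ∈ₗ p → v ∉ g
    g     : Subset m
    g∈p   : g ∈ₗ p
    u     : Fin m
    u∈g   : u ∈ g
    facet : f - v ≡ g - u

  old : ∀ {y} → y ∈ f → y ≢ v → y ∈ g - u
  old y∈f y≢v = subst (_ ∈_) facet (x∈p∧x≢y⇒x∈p-y y∈f y≢v)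

attach : ∀ {p : List (Subset m)} {f g v} → ∣ f ∣ ≡ ∣ g ∣ → v ∈ f → (∀ {h} → h ∈ₗ p → v ∉ h) →
         g ∈ₗ p → f - v ⊆ g → Attachment p f
attach ∣f∣≡∣g∣ v∈f fresh g∈p sub with facet-of sub (trans (sym ∣f∣≡∣g∣) (x∈p⇒∣p∣≡1+∣p-x∣ v∈f))
... | u , u∈g , eq = record { v∈f = v∈f ; fresh = fresh ; g∈p = g∈p ; u∈g = u∈g ; facet = eq }

-- The family p built so far is kept with its newest edge first.
data Growth {m : ℕ} : (p fs : List (Subset m)) → Set where
  []  : ∀ {p} → Growth p []
  _∷_ : ∀ {p f fs} → Attachment p f → Growth (f ∷ p) fs → Growth p (f ∷ fs)

∈-ʳ++⁺ : ∀ (xs : List A) {ys x} → x ∈ₗ xs ⊎ x ∈ₗ ys → x ∈ₗ xs ʳ++ ys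
∈-ʳ++⁺ []       (inj₂ x∈)          = x∈
∈-ʳ++⁺ (_ ∷ xs) (inj₁ (here refl)) = ∈-ʳ++⁺ xs (inj₂ (here refl))
∈-ʳ++⁺ (_ ∷ xs) (inj₁ (there x∈))  = ∈-ʳ++⁺ xs (inj₁ x∈)
∈-ʳ++⁺ (_ ∷ xs) (inj₂ x∈)          = ∈-ʳ++⁺ xs (inj₂ (there x∈))

∈-ʳ++⁻ : ∀ (xs : List A) {ys x} → x ∈ₗ xs ʳ++ ys → x ∈ₗ xs ⊎ x ∈ₗ ys
∈-ʳ++⁻ []       x∈ = inj₂ x∈
∈-ʳ++⁻ (_ ∷ xs) x∈ with ∈-ʳ++⁻ xs x∈
... | inj₁ x∈xs         = inj₁ (there x∈xs)
... | inj₂ (here refl)  = inj₁ (here refl)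
... | inj₂ (there x∈ys) = inj₂ x∈ys

growth-++⁻ : ∀ {p : List (Subset m)} xs {ys} → Growth p (xs ++ ys) → Growth p xs × Growth (xs ʳ++ p) ys
growth-++⁻ []       grow         = [] , grow
growth-++⁻ (_ ∷ xs) (att ∷ grow) = let l , r = growth-++⁻ xs grow in att ∷ l , r

∈⋃ : ∀ {fs : List (Subset m)} {f v} → f ∈ₗ fs → v ∈ f → v ∈ ⋃ fs
∈⋃ (here refl)             v∈f = p⊆p∪q _ v∈f
∈⋃ (there {x = g} f∈fs) v∈f = q⊆p∪q g _ (∈⋃ f∈fs v∈f)

∈⋃⁻ : ∀ {fs : List (Subset m)} {v} → v ∈ ⋃ fs → ∃[ f ] f ∈ₗ fs × v ∈ f
∈⋃⁻ {fs = []}     v∈ = contradiction v∈ ∉⊥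
∈⋃⁻ {fs = f ∷ fs} v∈ with x∈p∪q⁻ f (⋃ fs) v∈
... | inj₁ v∈f = f , here refl , v∈f
... | inj₂ v∈  = let g , g∈ , v∈g = ∈⋃⁻ {fs = fs} v∈ in g , there g∈ , v∈g

-- `go` splits the prefix before each position into the part already moved to `p` and a `take` of
-- the remaining list, so passing to the next edge only shifts the index. At position 0 the second
-- part is empty, so the neighbour is found in `p`.
tightOrder⇒growth : ∀ {r} {f : Subset m} {fs} → (∀ {g} → g ∈ₗ f ∷ fs → ∣ g ∣ ≡ r) →
                    TightOrder (f ∷ fs) → Growth (f ∷ []) fs
tightOrder⇒growth {m} {r} {f} {fs} unif tight = go (f ∷ []) fs
  (λ { (here refl) → unif (here refl) }) (unif ∘ there) λ i →
    let v , v∈ , v∉ , sub = tight (suc i) (s≤s z≤n) in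
    v , v∈ , (λ { (here refl) v∈f → v∉ (∈⋃ {fs = f ∷ take (toℕ i) fs} (here refl) v∈f) })
    , (λ v∈⋃ → v∉ (q⊆p∪q f _ v∈⋃)) , Sum.map₁ here (Any.toSum sub)
  where
  go : ∀ p fs → (∀ {g} → g ∈ₗ p → ∣ g ∣ ≡ r) → (∀ {g} → g ∈ₗ fs → ∣ g ∣ ≡ r) →
       ((i : Fin (length fs)) → ∃[ v ] v ∈ lookup fs i × (∀ {g} → g ∈ₗ p → v ∉ g) × v ∉ ⋃ (take (toℕ i) fs)
          × (Any ((lookup fs i - v) ⊆_) p ⊎ Any ((lookup fs i - v) ⊆_) (take (toℕ i) fs))) →
       Growth p fs
  go p []       _    _     _   = []
  go p (f ∷ fs) unifₚ unif hyp with hyp zero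
  ... | v , v∈f , fresh , _ , inj₁ some =
    let g , g∈p , sub = find some
    in  attach (trans (unif (here refl)) (sym (unifₚ g∈p))) v∈f fresh g∈p sub
        ∷ go (f ∷ p) fs (λ { (here refl) → unif (here refl) ; (there g∈) → unifₚ g∈ }) (unif ∘ there) λ i →
            let v , v∈ , fresh , v∉ , sub = hyp (suc i) in
            v , v∈ , (λ { (here refl) v∈f → v∉ (p⊆p∪q _ v∈f) ; (there g∈) → fresh g∈ })
            , (λ v∈⋃ → v∉ (q⊆p∪q f _ v∈⋃))
            , Sum.[ inj₁ ∘ there , Sum.map₁ here ∘ Any.toSum ]′ sub

-- Colouring the trunk.

_[_≔_] : (Fin m → A) → Fin m → A → Fin m → A
φ [ v ≔ x ] = updateAt φ v (const x)

≔-new : ∀ (φ : Fin m → A) {v x} → (φ [ v ≔ x ]) v ≡ x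
≔-new φ {v} = updateAt-updates v φ

≔-old : ∀ (φ : Fin m → A) {v x y} → y ≢ v → (φ [ v ≔ x ]) y ≡ φ y
≔-old φ {v} {y = y} y≢v = updateAt-minimal y v φ y≢v

-- The new vertex takes the colour of the vertex `u` that it replaces. A clash inside `f` would be a
-- vertex of `g - u` with the colour of `u`; earlier edges are unaffected because `v` is fresh.
rainbow-extends : ∀ {C : Set} {p fs : List (Subset m)} → Growth p fs →
  (κ : Fin m → C) → (∀ {h} → h ∈ₗ p → InjectiveOn h κ) →
  Σ[ κ′ ∈ (Fin m → C) ] (∀ {h} → h ∈ₗ fs ʳ++ p → InjectiveOn h κ′)
rainbow-extends []           κ inj = κ , inj
rainbow-extends {m} {C} {p} {f ∷ fs} (att ∷ grow) κ inj = rainbow-extends {C = C} grow κ′ inj′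
  where
  open Attachment att
  κ′ : Fin m → C
  κ′ = κ [ v ≔ κ u ]
  unchanged : ∀ {y} → y ≢ v → κ′ y ≡ κ y
  unchanged = ≔-old {A = C} κ
  clash : ∀ {y} → y ∈ f → y ≢ v → κ′ v ≢ κ′ y
  clash y∈f y≢v eq = x∉p-x (subst (_∈ g - u) (sym (inj g∈p u∈g (p-x⊆p (old y∈f y≢v))
    (trans (sym (≔-new κ)) (trans eq (unchanged y≢v))))) (old y∈f y≢v))
  inj′ : ∀ {h} → h ∈ₗ f ∷ p → InjectiveOn h κ′
  inj′ (there h∈p) x∈h y∈h eq = inj h∈p x∈h y∈h
    (trans (sym (unchanged λ { refl → fresh h∈p x∈h })) (trans eq (unchanged λ { refl → fresh h∈p y∈h })))
  inj′ (here refl) {x} {y} x∈f y∈f eq with x ≟ v | y ≟ v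
  ... | yes refl | yes refl = refl
  ... | yes refl | no  y≢v  = contradiction eq (clash y∈f y≢v)
  ... | no  x≢v  | yes refl = contradiction (sym eq) (clash x∈f x≢v)
  ... | no  x≢v  | no  y≢v  = inj g∈p (p-x⊆p (old x∈f x≢v)) (p-x⊆p (old y∈f y≢v))
    (trans (sym (unchanged x≢v)) (trans eq (unchanged y≢v)))

-- Extending a partial embedding by one edge.

∪-restore : ∀ {p S : Subset n} {x} → x ∈ p → p - x ≡ S → p ≡ S ∪ ⁅ x ⁆
∪-restore {p = p} {S} {x} x∈p refl = ⊆-antisym ⊆₁ ⊆₂
  where
  ⊆₁ : p ⊆ (p - x) ∪ ⁅ x ⁆
  ⊆₁ {y} y∈p with y ≟ x
  ... | yes refl = q⊆p∪q (p - x) ⁅ x ⁆ (x∈⁅x⁆ x)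
  ... | no  y≢x  = p⊆p∪q ⁅ x ⁆ (x∈p∧x≢y⇒x∈p-y y∈p y≢x)
  ⊆₂ : (p - x) ∪ ⁅ x ⁆ ⊆ p
  ⊆₂ y∈ with x∈p∪q⁻ (p - x) ⁅ x ⁆ y∈
  ... | inj₁ y∈p-x = p-x⊆p y∈p-x
  ... | inj₂ y∈x   = subst (_∈ p) (sym (x∈⁅y⁆⇒x≡y x y∈x)) x∈p

-- A set of `L` through `S` is determined by its one further vertex; if all these vertices lay in
-- `X`, there would be at most `length X` such sets.
free-extension : ∀ {L : List (Subset n)} {S} (X : List (Fin n)) → Unique L →
  (∀ {p} → p ∈ₗ L → ∣ p ∣ ≡ suc ∣ S ∣) → length X < degree L S → ∃[ p ] ∃[ x ] p ∈ₗ L × x ∈ p × p - x ≡ S × x ∉ₗ X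
free-extension {L = L} {S} X uL unif X<deg
  with any? (λ p → any?ᶠ λ x → (x ∈? p) ×-dec ((p - x) ≟ₛ S) ×-dec ¬? (any? (x ≟_) X)) L
... | yes some = let p , p∈L , x , x∈p , eq , x∉X = find some in p , x , p∈L , x∈p , eq , x∉X
... | no  none = contradiction (subst (degree L S ≤_) (length-map (λ x → S ∪ ⁅ x ⁆) X)
                   (length-⊆ (Unique.filter⁺ (S ⊆?_) uL) blocked)) (<⇒≱ X<deg)
  where
  blocked : filter (S ⊆?_) L ⊆ₗ map (λ x → S ∪ ⁅ x ⁆) X
  blocked {p} p∈ with ∈-filter⁻ (S ⊆?_) {xs = L} p∈
  ... | p∈L , S⊆p with facet-of S⊆p (unif p∈L)
  ... | x , x∈p , eq = subst (_∈ₗ _) (sym (∪-restore x∈p (sym eq))) (∈-map⁺ (λ x → S ∪ ⁅ x ⁆)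
    (decidable-stable (any? (x ≟_) X) λ x∉X → none (lose p∈L (x , x∈p , sym eq , x∉X))))

-- Injectivity on all vertices covered by `p`, stated through pairs of edges so that no union has to
-- be maintained as `p` grows.
record Embedding (L : List (Subset n)) (p : List (Subset m)) (φ : Fin m → Fin n) : Set where
  field
    injective : ∀ {h h′ x y} → h ∈ₗ p → h′ ∈ₗ p → x ∈ h → y ∈ h′ → φ x ≡ φ y → x ≡ y
    maps      : ∀ {h} → h ∈ₗ p → image φ h ∈ₗ L

module _ {L : List (Subset n)} {p : List (Subset m)} {φ : Fin m → Fin n} (emb : Embedding L p φ)
         {f} (att : Attachment p f) where
  open Embedding emb
  open Attachment att

  image-facet : image φ g - φ u ≡ image φ (g - u)
  image-facet = sym (image-- φ u∈g (injective g∈p g∈p))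

  ≔-stable : ∀ {x h y} → h ∈ₗ p → y ∈ h → (φ [ v ≔ x ]) y ≡ φ y
  ≔-stable h∈p y∈h = ≔-old φ λ { refl → fresh h∈p y∈h }

  extend : ∀ {e₁ x} → (∀ {h y} → h ∈ₗ p → y ∈ h → φ y ≢ x) →
           e₁ ∈ₗ L → x ∈ e₁ → e₁ - x ≡ image φ (g - u) → Embedding L (f ∷ p) (φ [ v ≔ x ])
  extend {e₁} {x} x-free e₁∈L x∈e₁ eq = record { injective = inj′ ; maps = maps′ }
    where
    φ′ : Fin m → Fin n
    φ′ = φ [ v ≔ x ]
    classify : ∀ {h y} → h ∈ₗ f ∷ p → y ∈ h → y ≡ v ⊎ ∃[ h′ ] h′ ∈ₗ p × y ∈ h′
    classify (there h∈p) y∈h = inj₂ (_ , h∈p , y∈h)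
    classify {y = y} (here refl) y∈f with y ≟ v
    ... | yes y≡v = inj₁ y≡v
    ... | no  y≢v = inj₂ (g , g∈p , p-x⊆p (old y∈f y≢v))
    inj′ : ∀ {h h′ x y} → h ∈ₗ f ∷ p → h′ ∈ₗ f ∷ p → x ∈ h → y ∈ h′ → φ′ x ≡ φ′ y → x ≡ y
    inj′ h∈ h′∈ y∈h z∈h′ φ′≡ with classify h∈ y∈h | classify h′∈ z∈h′
    ... | inj₁ refl             | inj₁ refl             = refl
    ... | inj₁ refl             | inj₂ (_ , k∈p , z∈k)  =
      contradiction (trans (sym (≔-stable k∈p z∈k)) (trans (sym φ′≡) (≔-new φ))) (x-free k∈p z∈k)
    ... | inj₂ (_ , k∈p , y∈k)  | inj₁ refl             =
      contradiction (trans (sym (≔-stable k∈p y∈k)) (trans φ′≡ (≔-new φ))) (x-free k∈p y∈k)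
    ... | inj₂ (_ , k∈p , y∈k)  | inj₂ (_ , k′∈p , z∈k′) =
      injective k∈p k′∈p y∈k z∈k′ (trans (sym (≔-stable k∈p y∈k)) (trans φ′≡ (≔-stable k′∈p z∈k′)))
    -- Both sets contain `x`, so it is enough to compare them without it; there the map has not
    -- changed, since `v` is fresh for `g`.
    new-image : image φ′ f ≡ e₁
    new-image = -‿injective (subst (_∈ image φ′ f) (≔-new φ) (∈-image⁺ φ′ v∈f)) x∈e₁ (begin
      image φ′ f - x       ≡⟨ cong (image φ′ f -_) (≔-new φ) ⟨
      image φ′ f - φ′ v    ≡⟨ image-- φ′ v∈f (inj′ (here refl) (here refl)) ⟨
      image φ′ (f - v)     ≡⟨ cong (image φ′) facet ⟩
      image φ′ (g - u)     ≡⟨ image-cong (λ y∈ → ≔-stable g∈p (p-x⊆p y∈)) ⟩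
      image φ (g - u)      ≡⟨ eq ⟨
      e₁ - x               ∎)
      where open ≡-Reasoning
    maps′ : ∀ {h} → h ∈ₗ f ∷ p → image φ′ h ∈ₗ L
    maps′ (here refl) = subst (_∈ₗ L) (sym new-image) e₁∈L
    maps′ (there h∈p) = subst (_∈ₗ L) (sym (image-cong (≔-stable h∈p))) (maps h∈p)

-- Embedding the trunk with its colours.

module EmbedTrunk {r c : ℕ} {H : List (Subset n)} (dense : Dense c H)
  (χ : Fin n → Fin (suc r)) (χ-rainbow : ∀ {p} → p ∈ₗ H → InjectiveOn p χ)
  (uniformᴴ : ∀ {p} → p ∈ₗ H → ∣ p ∣ ≡ suc r)
  (κ : Fin m → Fin (suc r)) where

  Coloured : List (Subset m) → (Fin m → Fin n) → Set
  Coloured p φ = ∀ {h y} → h ∈ₗ p → y ∈ h → χ (φ y) ≡ κ y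

  -- An edge of `H` shows every colour exactly once, so the colour `κ y` alone says where `y` goes.
  start : ∀ {f} → ∣ f ∣ ≡ suc r → InjectiveOn f κ → ∃[ φ ] Embedding H (f ∷ []) φ × Coloured (f ∷ []) φ
  start {f} ∣f∣≡ κ-rainbow = φ , record
    { injective = λ { (here refl) (here refl) → φ-inj }
    ; maps      = λ { (here refl) → subst (_∈ₗ H) (sym image≡e₀) e₀∈H } }
    , λ _ _ → χφ≡κ _
    where
    e₀   = proj₁ (Dense.nonempty dense)
    e₀∈H = proj₂ (Dense.nonempty dense)
    ψ : ∀ i → ∃[ y ] y ∈ e₀ × χ y ≡ i
    ψ = rainbow-surjective (uniformᴴ e₀∈H) (χ-rainbow e₀∈H)
    φ : Fin m → Fin n
    φ y = proj₁ (ψ (κ y))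
    χφ≡κ : ∀ y → χ (φ y) ≡ κ y
    χφ≡κ y = proj₂ (proj₂ (ψ (κ y)))
    φ-inj : InjectiveOn f φ
    φ-inj x∈f y∈f φx≡φy = κ-rainbow x∈f y∈f (trans (sym (χφ≡κ _)) (trans (cong χ φx≡φy) (χφ≡κ _)))
    image≡e₀ : image φ f ≡ e₀
    image≡e₀ = ⊆∧∣≥∣⇒≡ ⊆e₀ (subst (_≤ ∣ image φ f ∣) (trans ∣f∣≡ (sym (uniformᴴ e₀∈H))) (∣image∣ φ φ-inj))
      where
      ⊆e₀ : image φ f ⊆ e₀
      ⊆e₀ y∈ with ∈-image⁻ φ y∈
      ... | x , _ , refl = proj₁ (proj₂ (ψ (κ x)))

  -- Codegree above `c` suffices although the edges in `p` may span more than `c` vertices: the new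
  -- image has the colour of `u`, so it can collide only with vertices of that colour, and each edge
  -- of `p` has at most one.
  step : ∀ {f p φ} → Attachment p f → length p ≤ c → (∀ {h} → h ∈ₗ f ∷ p → ∣ h ∣ ≡ suc r) →
         (∀ {h} → h ∈ₗ f ∷ p → InjectiveOn h κ) → Embedding H p φ → Coloured p φ →
         ∃[ φ′ ] Embedding H (f ∷ p) φ′ × Coloured (f ∷ p) φ′
  step {f} {p} {φ} att p≤c unif κ-rainbow emb col =
    φ [ v ≔ x ] , extend emb att x-free e₁∈H x∈e₁ e₁-x , col′
    where
    open Attachment att
    open Embedding emb
    e₀∈H = maps g∈p
    φu∈e₀ = ∈-image⁺ φ u∈g
    pick : Subset m → Fin m
    pick h with any?ᶠ (λ y → (y ∈? h) ×-dec (κ y ≟ κ u))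
    ... | yes (y , _) = y
    -- A junk value: `pick≡` consults `pick` only where a vertex of this colour is known.
    ... | no  _       = u
    pick≡ : ∀ {h y} → h ∈ₗ p → y ∈ h → κ y ≡ κ u → pick h ≡ y
    pick≡ {h} h∈p y∈h κy≡ with any?ᶠ (λ y → (y ∈? h) ×-dec (κ y ≟ κ u))
    ... | yes (z , z∈h , κz≡) = κ-rainbow (there h∈p) z∈h y∈h (trans κz≡ (sym κy≡))
    ... | no  none            = contradiction (_ , y∈h , κy≡) none
    X = map (φ ∘ pick) p
    X<deg : length X < degree H (image φ g - φ u)
    X<deg = subst (_< _) (sym (length-map (φ ∘ pick) p)) (≤-<-trans p≤c (Dense.codegree dense e₀∈H φu∈e₀))
    extension = free-extension X (Dense.unique dense)
      (λ q∈H → trans (uniformᴴ q∈H) (trans (sym (uniformᴴ e₀∈H)) (x∈p⇒∣p∣≡1+∣p-x∣ φu∈e₀))) X<deg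
    e₁ = proj₁ extension
    x  = proj₁ (proj₂ extension)
    e₁∈H : e₁ ∈ₗ H
    e₁∈H = proj₁ (proj₂ (proj₂ extension))
    x∈e₁ : x ∈ e₁
    x∈e₁ = proj₁ (proj₂ (proj₂ (proj₂ extension)))
    e₁-x′ : e₁ - x ≡ image φ g - φ u
    e₁-x′ = proj₁ (proj₂ (proj₂ (proj₂ (proj₂ extension))))
    x∉X : x ∉ₗ X
    x∉X = proj₂ (proj₂ (proj₂ (proj₂ (proj₂ extension))))
    e₁-x : e₁ - x ≡ image φ (g - u)
    e₁-x = trans e₁-x′ (image-facet emb att)
    χx≡κu : χ x ≡ κ u
    χx≡κu = trans (exchange (uniformᴴ e₀∈H) (χ-rainbow e₁∈H) (χ-rainbow e₀∈H) x∈e₁ φu∈e₀ e₁-x′) (col g∈p u∈g)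
    κv≡κu : κ v ≡ κ u
    κv≡κu = exchange (unif (there g∈p)) (κ-rainbow (here refl)) (κ-rainbow (there g∈p)) v∈f u∈g facet
    x-free : ∀ {h y} → h ∈ₗ p → y ∈ h → φ y ≢ x
    x-free h∈p y∈h φy≡x = x∉X (subst (_∈ₗ X) (trans (cong φ (pick≡ h∈p y∈h
      (trans (sym (col h∈p y∈h)) (trans (cong χ φy≡x) χx≡κu)))) φy≡x) (∈-map⁺ (φ ∘ pick) h∈p))
    col′ : Coloured (f ∷ p) (φ [ v ≔ x ])
    col′ (there h∈p) y∈h = trans (cong χ (≔-stable emb att h∈p y∈h)) (col h∈p y∈h)
    col′ {y = y} (here refl) y∈f with y ≟ v
    ... | yes refl = trans (cong χ (≔-new φ)) (trans χx≡κu (sym κv≡κu))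
    ... | no  y≢v  = trans (cong χ (≔-old φ y≢v)) (col g∈p (p-x⊆p (old y∈f y≢v)))

  embed : ∀ {p fs φ} → Growth p fs → length fs + length p ≤ suc c → (∀ {h} → h ∈ₗ fs ʳ++ p → ∣ h ∣ ≡ suc r) →
          (∀ {h} → h ∈ₗ fs ʳ++ p → InjectiveOn h κ) → Embedding H p φ → Coloured p φ →
          ∃[ φ′ ] Embedding H (fs ʳ++ p) φ′ × Coloured (fs ʳ++ p) φ′
  embed []                              _     _    _         emb col = _ , emb , col
  embed {p} {f ∷ fs} (att ∷ grow) small unif κ-rainbow emb col =
    -- As `f` still has to be placed, `p` has at most `c` edges.
    let φ′ , emb′ , col′ = step att (≤-pred (≤-trans (s≤s (m≤n+m (length p) (length fs))) small))
                             (unif ∘ ∈-ʳ++⁺ fs ∘ inj₂) (κ-rainbow ∘ ∈-ʳ++⁺ fs ∘ inj₂) emb col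
    in  embed grow (subst (_≤ suc c) (sym (+-suc (length fs) (length p))) small) unif κ-rainbow emb′ col′

Covers : List (Fin m) → List (Subset m) → Set
Covers W p = ∀ {h y} → h ∈ₗ p → y ∈ h → y ∈ₗ W

-- Each attachment adds only its tip to the vertices covered.
growth-cover : ∀ {p fs : List (Subset m)} {W} → Growth p fs → Covers W p →
               ∃[ W′ ] Covers W′ (fs ʳ++ p) × length W′ ≡ length fs + length W
growth-cover {W = W} []           cover = W , cover , refl
growth-cover {p = p} {f ∷ fs} {W} (att ∷ grow) cover =
  let W′ , cover′ , eq = growth-cover grow cover₁ in W′ , cover′ , trans eq (+-suc (length fs) (length W))
  where
  open Attachment att
  cover₁ : Covers (v ∷ W) (f ∷ p)
  cover₁ (there h∈p) y∈h = there (cover h∈p y∈h)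
  cover₁ {y = y} (here refl) y∈f with y ≟ v
  ... | yes refl = here refl
  ... | no  y≢v  = there (cover g∈p (p-x⊆p (old y∈f y≢v)))

-- Leaf edges and their embedding.

-- The attachment is to the trunk itself, whereas the given order of the tree may attach the same
-- edge to another leaf edge. Leaf edges can therefore be reordered freely.
Leaf : List (Subset m) → Set
Leaf trunk = ∃[ f ] Attachment trunk f

module _ {trunk : List (Subset m)} where

  edge : Leaf trunk → Subset m
  edge = proj₁

  tip : Leaf trunk → Fin m
  tip (_ , att) = Attachment.v att

  opposite : Leaf trunk → Fin m
  opposite (_ , att) = Attachment.u att

  base : Leaf trunk → Subset m
  base (_ , att) = Attachment.g att

  Apart : Leaf trunk → Leaf trunk → Set
  Apart ℓ ℓ′ = tip ℓ ≢ tip ℓ′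

  -- The trunk edge `g` adjacent to `f` misses the fresh vertex `v`, so `f ∩ g` lies in `f - v` and
  -- equals it by size. The last component carries the induction: later tips avoid every edge
  -- already present, in particular `f`, and hence differ from `v`.
  collect-leaves : ∀ {r p fs} → (∀ {h} → h ∈ₗ trunk → h ∈ₗ p) → Growth p fs →
    (∀ {h} → h ∈ₗ trunk → ∣ h ∣ ≡ suc r) → (∀ {h} → h ∈ₗ fs → ∣ h ∣ ≡ suc r) →
    (∀ {f} → f ∈ₗ fs → f ∉ₗ trunk → ∃[ g ] g ∈ₗ trunk × ∣ f ∩ g ∣ ≡ r) →
    ∃[ Ls ] map edge Ls ≡ fs × AllPairs Apart Ls × All (λ ℓ → ∀ h → h ∈ₗ p → tip ℓ ∉ h) Ls
  collect-leaves trunk⊆p []           unifₜ unif adj = [] , refl , [] , []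
  collect-leaves {r} {p} {f ∷ fs} trunk⊆p (att ∷ grow) unifₜ unif adj
    with adj (here refl) (λ f∈trunk → Attachment.fresh att (trunk⊆p f∈trunk) (Attachment.v∈f att))
       | collect-leaves (there ∘ trunk⊆p) grow unifₜ (unif ∘ there) (adj ∘ there)
  ... | g , g∈trunk , ∣f∩g∣≡r | Ls , refl , apart , fresh =
    ℓ ∷ Ls , refl , All.map (λ fresh-tip v≡ → fresh-tip f (here refl) (subst (_∈ f) v≡ v∈f)) fresh ∷ apart
    , (λ _ → Attachment.fresh att) ∷ All.map (λ fresh-tip h h∈p → fresh-tip h (there h∈p)) fresh
    where
    open Attachment att using (v; v∈f)
    f∩g⊆f-v : f ∩ g ⊆ f - v
    f∩g⊆f-v y∈ with x∈p∩q⁻ f g y∈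
    ... | y∈f , y∈g = x∈p∧x≢y⇒x∈p-y y∈f λ { refl → Attachment.fresh att (trunk⊆p g∈trunk) y∈g }
    ∣f-v∣≡r : ∣ f - v ∣ ≡ r
    ∣f-v∣≡r = cong pred (trans (sym (x∈p⇒∣p∣≡1+∣p-x∣ v∈f)) (unif (here refl)))
    f-v⊆g : f - v ⊆ g
    f-v⊆g = subst (_⊆ g) (⊆∧∣≥∣⇒≡ f∩g⊆f-v (≤-reflexive (trans ∣f-v∣≡r (sym ∣f∩g∣≡r)))) (p∩q⊆q f g)
    ℓ : Leaf trunk
    ℓ = f , attach (trans (unif (here refl)) (sym (unifₜ g∈trunk)))
                   v∈f (Attachment.fresh att ∘ trunk⊆p) g∈trunk f-v⊆g

module EmbedLeaves {r : ℕ} {L : List (Subset n)}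
  (unique-L : Unique L) (uniform-L : ∀ {p} → p ∈ₗ L → ∣ p ∣ ≡ suc r)
  {trunk : List (Subset m)} {W} (cover : Covers W trunk) (∣W∣≤ : length W ≤ r + length trunk)
  (uniformₜ : ∀ {h} → h ∈ₗ trunk → ∣ h ∣ ≡ suc r)
  {φ₀ : Fin m → Fin n} (emb₀ : Embedding L trunk φ₀) where

  -- At most `length trunk` trunk vertices lie off the facet, since `W` has at most
  -- `r + length trunk` entries and `r` of them can be charged to the facet. Each leaf edge placed
  -- before adds one tip.
  Room : List (Leaf trunk) → Set
  Room []       = Unit.⊤
  Room (ℓ ∷ Ls) = length trunk + length Ls < degree L (image φ₀ (base ℓ) - φ₀ (opposite ℓ)) × Room Ls

  -- The head of the list is embedded last.
  embed-leaves : ∀ Ls → AllPairs Apart Ls → Room Ls →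
    ∃[ φ ] Embedding L (map edge Ls ++ trunk) φ × (∀ {h y} → h ∈ₗ trunk → y ∈ h → φ y ≡ φ₀ y)
  embed-leaves []               _               _             = φ₀ , emb₀ , λ _ _ → refl
  embed-leaves (ℓ@(f , att) ∷ Ls) (apart ∷ aparts) (room , rooms) with embed-leaves Ls aparts rooms
  ... | φ , emb , agree = φ [ v ≔ x ] , extend emb att′ x-free e₁∈L x∈e₁ e₁-x
    , λ h∈ y∈h → trans (≔-stable emb att′ (∈-++⁺ʳ (map edge Ls) h∈) y∈h) (agree h∈ y∈h)
    where
    open Attachment att
    p = map edge Ls ++ trunk
    located : ∀ {h y} → h ∈ₗ p → y ∈ h → y ∈ₗ map tip Ls ⊎ ∃[ h′ ] h′ ∈ₗ trunk × y ∈ h′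
    located {h} {y} h∈p y∈h with ∈-++⁻ (map edge Ls) h∈p
    ... | inj₂ h∈trunk = inj₂ (h , h∈trunk , y∈h)
    ... | inj₁ h∈ with ∈-map⁻ edge h∈
    ... | ℓ′ , ℓ′∈Ls , refl with y ≟ tip ℓ′
    ... | yes refl = inj₁ (∈-map⁺ tip ℓ′∈Ls)
    ... | no  y≢   = inj₂ (base ℓ′ , Attachment.g∈p (proj₂ ℓ′) , p-x⊆p (Attachment.old (proj₂ ℓ′) y∈h y≢))
    fresh′ : ∀ {h} → h ∈ₗ p → v ∉ h
    fresh′ h∈p v∈h with located h∈p v∈h
    ... | inj₂ (_ , h′∈trunk , v∈h′) = fresh h′∈trunk v∈h′
    ... | inj₁ v∈ with ∈-map⁻ tip v∈
    ... | ℓ′ , ℓ′∈Ls , v≡ = All.lookup apart ℓ′∈Ls v≡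
    att′ : Attachment p f
    att′ = record { v∈f = v∈f ; fresh = fresh′ ; g∈p = ∈-++⁺ʳ (map edge Ls) g∈p ; u∈g = u∈g ; facet = facet }
    W′ = map tip Ls ++ W
    cover′ : Covers W′ p
    cover′ h∈p y∈h with located h∈p y∈h
    ... | inj₁ y∈                = ∈-++⁺ˡ y∈
    ... | inj₂ (_ , h′∈ , y∈h′) = ∈-++⁺ʳ (map tip Ls) (cover h′∈ y∈h′)
    S = image φ₀ g - φ₀ u
    S≡ : S ≡ image φ (g - u)
    S≡ = trans (image-facet emb₀ att) (image-cong λ y∈ → sym (agree g∈p (p-x⊆p y∈)))
    φ₀u∈ = ∈-image⁺ φ₀ u∈g
    ∣S∣≡ : suc r ≡ suc ∣ S ∣
    ∣S∣≡ = trans (sym (uniform-L (Embedding.maps emb₀ g∈p))) (x∈p⇒∣p∣≡1+∣p-x∣ φ₀u∈)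
    r≤∣g-u∣ : r ≤ ∣ g - u ∣
    r≤∣g-u∣ = ≤-pred (≤-reflexive (trans (sym (uniformₜ g∈p)) (x∈p⇒∣p∣≡1+∣p-x∣ u∈g)))
    -- Vertices of the facet are left out of the forbidden list: they map into `e₁ - x`, which
    -- excludes `x`.
    others = filter (¬? ∘ (_∈? (g - u))) W′
    X = map φ others
    X<deg : length X < degree L S
    X<deg = subst (_< _) (sym (length-map φ others)) (≤-<-trans (+-cancelˡ-≤ r _ _ (begin
      r + length others                                      ≤⟨ +-monoˡ-≤ (length others) r≤inside ⟩
      length (filter (_∈? (g - u)) W′) + length others       ≡⟨ length-filter-split (_∈? (g - u)) W′ ⟨
      length W′                                              ≡⟨ length-++ (map tip Ls) ⟩
      length (map tip Ls) + length W                         ≡⟨ cong (_+ length W) (length-map tip Ls) ⟩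
      length Ls + length W                                   ≤⟨ +-monoʳ-≤ (length Ls) ∣W∣≤ ⟩
      length Ls + (r + length trunk)                         ≡⟨ +-comm (length Ls) _ ⟩
      r + length trunk + length Ls                           ≡⟨ +-assoc r _ _ ⟩
      r + (length trunk + length Ls)                         ∎)) room)
      where
      open ≤-Reasoning
      inside-W′ : elements (g - u) ⊆ₗ filter (_∈? (g - u)) W′
      inside-W′ y∈ = let y∈′ = ∈-elements⁻ {p = g - u} y∈ in
        ∈-filter⁺ (_∈? (g - u)) (∈-++⁺ʳ (map tip Ls) (cover g∈p (p-x⊆p y∈′))) y∈′
      r≤inside : r ≤ length (filter (_∈? (g - u)) W′)
      r≤inside = begin
        r                                  ≤⟨ r≤∣g-u∣ ⟩
        ∣ g - u ∣                          ≡⟨ length-elements (g - u) ⟨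
        length (elements (g - u))          ≤⟨ length-⊆ (elements-unique (g - u)) inside-W′ ⟩
        length (filter (_∈? (g - u)) W′)   ∎
    extension = free-extension X unique-L (λ q∈L → trans (uniform-L q∈L) ∣S∣≡) X<deg
    e₁ = proj₁ extension
    x  = proj₁ (proj₂ extension)
    e₁∈L : e₁ ∈ₗ L
    e₁∈L = proj₁ (proj₂ (proj₂ extension))
    x∈e₁ : x ∈ e₁
    x∈e₁ = proj₁ (proj₂ (proj₂ (proj₂ extension)))
    e₁-x : e₁ - x ≡ image φ (g - u)
    e₁-x = trans (proj₁ (proj₂ (proj₂ (proj₂ (proj₂ extension))))) S≡
    x∉X : x ∉ₗ X
    x∉X = proj₂ (proj₂ (proj₂ (proj₂ (proj₂ extension))))
    x-free : ∀ {h y} → h ∈ₗ p → y ∈ h → φ y ≢ x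
    x-free {h} {y} h∈p y∈h φy≡x with y ∈? (g - u)
    ... | yes y∈ = x∉p-x (subst₂ _∈_ φy≡x (sym e₁-x) (∈-image⁺ φ y∈))
    ... | no  y∉ = x∉X (subst (_∈ₗ X) φy≡x (∈-map⁺ φ (∈-filter⁺ (¬? ∘ (_∈? (g - u))) (cover′ h∈p y∈h) y∉)))

-- Ordering the leaf edges by colour.

length-filter-∷ : {P : A → Set} (P? : Decidable P) (x : A) (xs : List A) →
                  length (filter P? xs) ≤ length (filter P? (x ∷ xs))
length-filter-∷ P? x xs with P? x
... | yes _ = n≤1+n _
... | no  _ = ≤-refl

module _ {A : Set} {r : ℕ} where

  -- The list is consumed from its end, so `suc (length xs)` counts the entries up to and including
  -- `x`.
  Spaced : (A → ℕ) → ℕ → List A → Set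
  Spaced colour D []       = Unit.⊤
  Spaced colour D (x ∷ xs) = suc r * suc (length xs) ≤ suc (colour x) * D × Spaced colour D xs

  module _ (colour : A → ℕ) where

    crowd : ℕ → List A → ℕ
    crowd i xs = length (filter (λ x → colour x ≤? i) xs)

    -- In a list sorted by decreasing colour, no element has a larger colour than an earlier one.
    spaced : ∀ D xs → AllPairs (λ x y → colour y ≤ colour x) xs →
             (∀ {x} → x ∈ₗ xs → suc r * crowd (colour x) xs ≤ suc (colour x) * D) → Spaced colour D xs
    spaced D []       _                 _     = _
    spaced D (x ∷ xs) (smaller ∷ pairs) bound =
      subst (λ k → suc r * k ≤ suc (colour x) * D)
        (cong length (filter-all (λ y → colour y ≤? colour x) (≤-refl ∷ smaller))) (bound (here refl))
      , spaced D xs pairs λ {y} y∈ →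
          ≤-trans (*-monoʳ-≤ (suc r) (length-filter-∷ (λ z → colour z ≤? colour y) x xs)) (bound (there y∈))

  balanced-order : (κ : A → Fin (suc r)) (xs : List A) →
    ∃[ σ ] ∃[ ys ] InjectiveOn ⊤ σ × ys ↭ xs × Spaced (λ x → toℕ {suc r} (σ (κ x))) (length xs) ys
  balanced-order κ xs with colour-order (map κ xs)
  ... | σ , σ-inj , bound = σ , sort xs , σ-inj , sort-↭ xs , spaced colour (length xs) (sort xs)
    (Linked.Linked⇒AllPairs (λ le le′ → ≤-trans le′ le) (sort-↗ xs)) λ {x} _ →
      subst₂ (λ a b → suc r * a ≤ suc (colour x) * b) (same-crowd x) (length-map κ xs) (bound (κ x))
    where
    colour : A → ℕ
    colour x = toℕ (σ (κ x))
    -- The order is flipped because the head of the list is embedded last: the smallest colours must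
    -- stand at the end.
    open Sort (On.decTotalOrder (Flip.decTotalOrder ≤-decTotalOrder) colour)
    same-crowd : ∀ x → length (filter (λ c → toℕ (σ c) ≤? colour x) (map κ xs)) ≡ crowd colour (colour x) (sort xs)
    same-crowd x = begin
      length (filter (λ c → toℕ (σ c) ≤? colour x) (map κ xs))
        ≡⟨ length-filter≡∑ (λ c → toℕ (σ c) ≤? colour x) (map κ xs) ⟩
      ∑[ c ← map κ xs ] 𝟙 (toℕ (σ c) ≤? colour x)              ≡⟨ cong sum (map-∘ xs) ⟨
      ∑[ y ← xs ] 𝟙 (colour y ≤? colour x)                     ≡⟨ length-filter≡∑ (λ y → colour y ≤? colour x) xs ⟨
      crowd colour (colour x) xs
        ≡⟨ ↭-length (filter-↭ (λ y → colour y ≤? colour x) (↭-sym (sort-↭ xs))) ⟩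
      crowd colour (colour x) (sort xs)                        ∎
      where open ≡-Reasoning

-- Assembling the embedding of the tree.

module _ {r c : ℕ} {G : RGraph (suc r) n} {f₀ : Subset m} {ts : List (Subset m)} (D : ℕ)
         (graded : Graded G (length ts + D + r * c) c)
         (grow : Growth (f₀ ∷ []) ts)
         (uniformₜ : ∀ {h} → h ∈ₗ ts ʳ++ (f₀ ∷ []) → ∣ h ∣ ≡ suc r)
         (ts≤c : length ts ≤ c)
         (κ : Fin m → Fin (suc r)) (κ-rainbow : ∀ {h} → h ∈ₗ ts ʳ++ (f₀ ∷ []) → InjectiveOn h κ) where

  open Graded graded

  private
    trunk : List (Subset m)
    trunk = ts ʳ++ (f₀ ∷ [])

    k≡ : length trunk ≡ suc (length ts)
    k≡ = trans (length-ʳ++ ts) (+-comm (length ts) 1)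

    f₀∈trunk : f₀ ∈ₗ trunk
    f₀∈trunk = ∈-ʳ++⁺ ts (inj₂ (here refl))

  trunk-embedding : ∃[ φ ] Embedding H trunk φ × (∀ {h y} → h ∈ₗ trunk → y ∈ h → χ (φ y) ≡ κ y)
  trunk-embedding = let φ , emb , col = ET.start (uniformₜ f₀∈trunk) (κ-rainbow f₀∈trunk) in
    ET.embed grow (subst (_≤ suc c) (+-comm 1 (length ts)) (s≤s ts≤c)) uniformₜ κ-rainbow emb col
    where
    module ET = EmbedTrunk dense χ rainbow (All.lookup (uniform G) ∘ H⊆G) κ

  trunk-cover : ∃[ W ] Covers W trunk × length W ≤ r + length trunk
  trunk-cover with growth-cover {W = elements f₀} grow (λ { (here refl) y∈ → ∈-elements⁺ y∈ })
  ... | W , cover , ∣W∣≡ = W , cover , ≤-reflexive (begin-equality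
    length W                          ≡⟨ ∣W∣≡ ⟩
    length ts + length (elements f₀)  ≡⟨ cong (length ts +_) (trans (length-elements f₀) (uniformₜ f₀∈trunk)) ⟩
    length ts + suc r                 ≡⟨ +-comm (length ts) (suc r) ⟩
    suc (r + length ts)               ≡⟨ +-suc r (length ts) ⟨
    r + suc (length ts)               ≡⟨ cong (r +_) k≡ ⟨
    r + length trunk                  ∎)
    where open ≤-Reasoning

  colour : Leaf trunk → ℕ
  colour ℓ = toℕ (κ (opposite ℓ))

  module _ {φ₀ : Fin m → Fin n} (emb : Embedding H trunk φ₀)
           (col : ∀ {h y} → h ∈ₗ trunk → y ∈ h → χ (φ₀ y) ≡ κ y) where

    -- As `bound` counts the leaf edge itself, one trunk edge can be traded for it. Writing
    -- `suc r * p` as `p + r * p` keeps `p + D`, the number of edges of the tree less one, exact and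
    -- replaces only the rest by `r * c`.
    room : ∀ (ℓ : Leaf trunk) j → suc r * suc j ≤ suc (colour ℓ) * D →
           length trunk + j < degree (edges G) (image φ₀ (base ℓ) - φ₀ (opposite ℓ))
    room ℓ@(_ , att) j bound = *-cancelˡ-< (suc r) _ _ (begin-strict
      suc r * (length trunk + j)                  ≡⟨ cong (λ x → suc r * (x + j)) k≡ ⟩
      suc r * (suc p + j)                         ≡⟨ cong (suc r *_) (+-suc p j) ⟨
      suc r * (p + suc j)                         ≡⟨ *-distribˡ-+ (suc r) p (suc j) ⟩
      suc r * p + suc r * suc j                   ≤⟨ +-mono-≤ (+-monoʳ-≤ p (*-monoʳ-≤ r ts≤c)) bound ⟩
      -- An equality for `i` = 0, the colour that dictates the size of `N`.
      p + r * c + suc i * D                       ≤⟨ +-monoˡ-≤ (suc i * D) (m≤m+n (p + r * c) (i * (p + r * c))) ⟩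
      suc i * (p + r * c) + suc i * D             ≡⟨ *-distribˡ-+ (suc i) (p + r * c) D ⟨
      suc i * (p + r * c + D)                     ≡⟨ cong (suc i *_) (xy∙z≈xz∙y p (r * c) D) ⟩
      suc i * (p + D + r * c)                     ≡⟨ *-comm (suc i) _ ⟩
      (p + D + r * c) * suc i                     ≡⟨ cong (λ x → (p + D + r * c) * suc (toℕ x)) (col g∈p u∈g) ⟨
      (p + D + r * c) * suc (toℕ (χ (φ₀ u)))      <⟨ rich (Embedding.maps emb g∈p) (∈-image⁺ φ₀ u∈g) ⟩
      suc r * degree (edges G) (image φ₀ g - φ₀ u) ∎)
      where
      open ≤-Reasoning
      open Attachment att
      i = colour ℓ
      p = length ts

  full-embedding : (Ls : List (Leaf trunk)) → AllPairs Apart Ls → Spaced {r = r} colour D Ls →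
                   ∃[ φ ] Embedding (edges G) (map edge Ls ++ trunk) φ
  full-embedding Ls apart gaps with trunk-embedding | trunk-cover
  ... | φ₀ , emb , col | W , cover , ∣W∣≤ = let φ , emb′ , _ = EL.embed-leaves Ls apart (roomy Ls gaps) in φ , emb′
    where
    emb₀ : Embedding (edges G) trunk φ₀
    emb₀ = record { injective = Embedding.injective emb ; maps = H⊆G ∘ Embedding.maps emb }
    module EL = EmbedLeaves (unique G) (All.lookup (uniform G)) cover ∣W∣≤ uniformₜ emb₀
    roomy : ∀ Ls → Spaced {r = r} colour D Ls → EL.Room Ls
    roomy []       _             = _
    roomy (ℓ ∷ Ls) (gap , gaps) = room emb col ℓ (length Ls) gap , roomy Ls gaps

allPairs-resp-↭ : ∀ {R : A → A → Set} {xs ys} → Symmetric R → xs ↭ ys → AllPairs R xs → AllPairs R ys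
allPairs-resp-↭ {A} {R} R-sym xs↭ys = AllPairs-resp-↭ (setoid A) R-sym (resp₂ R) (↭⇒↭ₛ xs↭ys)

-- Class sizes are known only after the trunk is coloured, so the colours are renamed afterwards by
-- the injective map `σ`.
leaf-order : ∀ {r} {trunk : List (Subset m)} (κ : Fin m → Fin (suc r))
  (Ls₀ : List (Leaf trunk)) → AllPairs Apart Ls₀ →
  Σ[ σ ∈ (Fin (suc r) → Fin (suc r)) ] Σ[ Ls ∈ List (Leaf trunk) ]
  InjectiveOn ⊤ σ × map edge Ls ↭ map edge Ls₀ × AllPairs Apart Ls
  × Spaced {r = r} (λ (ℓ : Leaf trunk) → toℕ (σ (κ (opposite ℓ)))) (length Ls₀) Ls
leaf-order κ Ls₀ apart = let σ , Ls , σ-inj , Ls↭Ls₀ , gaps = balanced-order (κ ∘ opposite) Ls₀ in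
  σ , Ls , σ-inj , map⁺ edge Ls↭Ls₀ , allPairs-resp-↭ {R = Apart} (λ {ℓ} {ℓ′} → ≢-sym) (↭-sym Ls↭Ls₀) apart , gaps

module _ {r c : ℕ} (T : RGraph (suc r) m) {f₀ : Subset m} {ts es : List (Subset m)}
         (all↭T : f₀ ∷ ts ++ es ↭ edges T) (tight : TightOrder (f₀ ∷ ts ++ es)) (ts≤c : length ts ≤ c)
         (adjacent : ∀ {f} → f ∈ₗ es → f ∉ₗ ts ʳ++ (f₀ ∷ []) → ∃[ g ] g ∈ₗ ts ʳ++ (f₀ ∷ []) × ∣ f ∩ g ∣ ≡ r)
         (G : RGraph (suc r) n) (graded : Graded G (length ts + length es + r * c) c) where

  private
    trunk : List (Subset m)
    trunk = ts ʳ++ (f₀ ∷ [])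

    uniformₐ : ∀ {h} → h ∈ₗ f₀ ∷ ts ++ es → ∣ h ∣ ≡ suc r
    uniformₐ h∈ = All.lookup (uniform T) (∈-resp-↭ all↭T h∈)

    uniformₜ : ∀ {h} → h ∈ₗ trunk → ∣ h ∣ ≡ suc r
    uniformₜ h∈ with ∈-ʳ++⁻ ts h∈
    ... | inj₁ h∈ts        = uniformₐ (there (∈-++⁺ˡ h∈ts))
    ... | inj₂ (here refl) = uniformₐ (here refl)

    grown : Growth (f₀ ∷ []) ts × Growth trunk es
    grown = growth-++⁻ ts (tightOrder⇒growth uniformₐ tight)

    trunk-colouring : Σ[ κ ∈ (Fin m → Fin (suc r)) ] (∀ {h} → h ∈ₗ trunk → InjectiveOn h κ)
    -- For constant `d` the rank is the position within `f₀`, which colours the first edge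
    -- injectively.
    trunk-colouring = rainbow-extends (proj₁ grown) (Rank.rankColour f₀ (λ _ → 0))
      λ { (here refl) → Rank.rankColour-injective f₀ (λ _ → 0) (uniformₐ (here refl)) }

    placed : ∀ {p h} → p ↭ es → h ∈ₗ edges T → h ∈ₗ p ++ trunk
    placed {p} p↭es h∈T with ∈-++⁻ (f₀ ∷ ts) (∈-resp-↭ (↭-sym all↭T) h∈T)
    ... | inj₁ (here refl)  = ∈-++⁺ʳ p (∈-ʳ++⁺ ts (inj₂ (here refl)))
    ... | inj₁ (there h∈ts) = ∈-++⁺ʳ p (∈-ʳ++⁺ ts (inj₁ h∈ts))
    ... | inj₂ h∈es         = ∈-++⁺ˡ (∈-resp-↭ (↭-sym p↭es) h∈es)

    embedding : ∃[ φ ] ∃[ p ] Embedding (edges G) p φ × (∀ {h} → h ∈ₗ edges T → h ∈ₗ p)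
    embedding =
      let κ₀ , κ₀-rainbow = trunk-colouring
          Ls₀ , Ls₀-edges , Ls₀-apart , _ =
            collect-leaves {trunk = trunk} id (proj₂ grown) uniformₜ
                           (λ h∈ → uniformₐ (there (∈-++⁺ʳ ts h∈))) adjacent
          σ , Ls , σ-inj , Ls↭Ls₀ , apart , gaps = leaf-order {trunk = trunk} κ₀ Ls₀ Ls₀-apart
          φ , emb = full-embedding {G = G} (length es) graded (proj₁ grown) uniformₜ ts≤c (σ ∘ κ₀)
            (λ h∈ x∈ y∈ eq → κ₀-rainbow h∈ x∈ y∈ (σ-inj ∈⊤ ∈⊤ eq)) Ls apart
            (subst (λ D → Spaced {r = r} (λ (ℓ : Leaf trunk) → toℕ {suc r} (σ (κ₀ (opposite ℓ)))) D Ls)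
                   (trans (sym (length-map edge Ls₀)) (cong length Ls₀-edges)) gaps)
      in  φ , map edge Ls ++ trunk , emb , placed (subst (map edge Ls ↭_) Ls₀-edges Ls↭Ls₀)

  ordered-tree-contained : Contains G T
  ordered-tree-contained = let φ , p , emb , placed = embedding in record
    { φ         = φ
    ; injective = λ x∈ y∈ →
        let h , h∈ , x∈h    = ∈⋃⁻ {fs = edges T} x∈
            h′ , h′∈ , y∈h′ = ∈⋃⁻ {fs = edges T} y∈
        in  Embedding.injective emb (placed h∈) (placed h′∈) x∈h y∈h′
    ; edge      = Embedding.maps emb ∘ placed
    }

tree-contained : ∀ {r c t} (T T′ : RGraph (suc r) m) → Trunk T′ T → e T ≡ suc t → e T′ ≤ suc c →
                 (G : RGraph (suc r) n) → Graded G (t + r * c) c → Contains G T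
tree-contained {m} {r = r} {c} {t} T T′ trunk-T ∣T∣≡ k≤1+c G graded with Trunk.ordering trunk-T
-- An empty trunk is impossible: the tree has an edge, and adjacency would give it a neighbour in
-- the trunk.
... | [] , es , []↭T′ , es↭T , _ = contradiction (proj₂ (member (≤-trans (s≤s z≤n) (≤-reflexive (sym ∣T∣≡))))) none
  where
  member : ∀ {xs : List (Subset m)} → 1 ≤ length xs → ∃[ x ] x ∈ₗ xs
  member {x ∷ _} _ = x , here refl
  T′-empty : ∀ {f} → f ∉ₗ edges T′
  T′-empty f∈ with ∈-resp-↭ (↭-sym []↭T′) f∈
  ... | ()
  none : ∀ {f} → f ∉ₗ edges T
  none f∈T = let _ , f′∈T′ , _ = Trunk.adjacent trunk-T f∈T T′-empty in T′-empty f′∈T′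
... | f₀ ∷ ts , es , ts↭T′ , all↭T , tight =
  ordered-tree-contained T all↭T tight (≤-pred (subst (_≤ suc c) (sym (↭-length ts↭T′)) k≤1+c)) adjacent′ G
    (subst (λ s → Graded G (s + r * c) c) t≡ graded)
  where
  t≡ : t ≡ length ts + length es
  t≡ = cong pred (trans (sym ∣T∣≡) (trans (sym (↭-length all↭T)) (cong suc (length-++ ts))))
  T′⇒trunk : ∀ {h} → h ∈ₗ edges T′ → h ∈ₗ ts ʳ++ (f₀ ∷ [])
  T′⇒trunk h∈ with ∈-resp-↭ (↭-sym ts↭T′) h∈
  ... | here refl  = ∈-ʳ++⁺ ts (inj₂ (here refl))
  ... | there h∈ts = ∈-ʳ++⁺ ts (inj₁ h∈ts)
  adjacent′ : ∀ {f} → f ∈ₗ es → f ∉ₗ ts ʳ++ (f₀ ∷ []) → ∃[ g ] g ∈ₗ ts ʳ++ (f₀ ∷ []) × ∣ f ∩ g ∣ ≡ r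
  adjacent′ f∈es f∉trunk =
    let g , g∈T′ , eq = Trunk.adjacent trunk-T (∈-resp-↭ all↭T (there (∈-++⁺ʳ ts f∈es))) (f∉trunk ∘ T′⇒trunk)
    in  g , T′⇒trunk g∈T′ , eq

-- The theorem multiplied by its r, with all parameters written as successors: `t + r * c` is N, and
-- the other summand comes from r^r (c - 1).
few-edges : ∀ {r c t} (T T′ : RGraph (suc r) m) → Trunk T′ T → e T ≡ suc t → e T′ ≤ suc c →
            (G : RGraph (suc r) n) → ¬ Contains G T →
            e G * suc r ≤ (t + r * c + suc r * (suc r ^ suc r * c)) * e (∂ G)
few-edges {r = r} {c} {t} T T′ trunk-T ∣T∣≡ k≤1+c G T⊄G = ≮⇒≥ λ many →
  T⊄G (tree-contained T T′ trunk-T ∣T∣≡ k≤1+c G (graded-subgraph G (t + r * c) c many))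

-- Passage to rational numbers.

toℚᵘ-/ : ∀ z d → toℚᵘ (z ℚ./ suc d) ℚᵘ.≃ mkℚᵘ z d
toℚᵘ-/ z d = ℚ.toℚᵘ-fromℚᵘ (mkℚᵘ z d)

fromℕ-+ : ∀ a b → fromℕ (a + b) ≡ fromℕ a ℚ.+ fromℕ b
fromℕ-+ a b = ℚ.toℚᵘ-injective (begin
  toℚᵘ (fromℕ (a + b))               ≈⟨ toℚᵘ-/ (ℤ.+ (a + b)) 0 ⟩
  mkℚᵘ (ℤ.+ (a + b)) 0                 ≈⟨ *≡* (cong (ℤ._* ℤ.+ 1) (cong₂ ℤ._+_ (sym (ℤ.*-identityʳ (ℤ.+ a)))
                                                                             (sym (ℤ.*-identityʳ (ℤ.+ b))))) ⟩
  mkℚᵘ (ℤ.+ a) 0 ℚᵘ.+ mkℚᵘ (ℤ.+ b) 0       ≈⟨ ℚᵘ.+-cong (toℚᵘ-/ (ℤ.+ a) 0) (toℚᵘ-/ (ℤ.+ b) 0) ⟨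
  toℚᵘ (fromℕ a) ℚᵘ.+ toℚᵘ (fromℕ b)   ≈⟨ ℚ.toℚᵘ-homo-+ (fromℕ a) (fromℕ b) ⟨
  toℚᵘ (fromℕ a ℚ.+ fromℕ b)           ∎)
  where open ℚᵘ.≃-Reasoning

fromℕ-* : ∀ a b → fromℕ (a * b) ≡ fromℕ a ℚ.* fromℕ b
fromℕ-* a b = ℚ.toℚᵘ-injective (begin
  toℚᵘ (fromℕ (a * b))               ≈⟨ toℚᵘ-/ (ℤ.+ (a * b)) 0 ⟩
  mkℚᵘ (ℤ.+ (a * b)) 0                 ≈⟨ *≡* (cong (ℤ._* (ℤ.+ 1)) (ℤ.pos-* a b)) ⟩
  mkℚᵘ (ℤ.+ a) 0 ℚᵘ.* mkℚᵘ (ℤ.+ b) 0       ≈⟨ ℚᵘ.*-cong (toℚᵘ-/ (ℤ.+ a) 0) (toℚᵘ-/ (ℤ.+ b) 0) ⟨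
  toℚᵘ (fromℕ a) ℚᵘ.* toℚᵘ (fromℕ b)   ≈⟨ ℚ.toℚᵘ-homo-* (fromℕ a) (fromℕ b) ⟨
  toℚᵘ (fromℕ a ℚ.* fromℕ b)           ∎)
  where open ℚᵘ.≃-Reasoning

fromℕ-mono : ∀ {a b} → a ≤ b → fromℕ a ℚ.≤ fromℕ b
fromℕ-mono {a} {b} a≤b = ℚ.toℚᵘ-cancel-≤ (begin
  toℚᵘ (fromℕ a)   ≃⟨ toℚᵘ-/ (ℤ.+ a) 0 ⟩
  mkℚᵘ (ℤ.+ a) 0     ≤⟨ *≤* (ℤ.*-monoʳ-≤-nonNeg (ℤ.+ 1) (ℤ.+≤+ a≤b)) ⟩
  mkℚᵘ (ℤ.+ b) 0     ≃⟨ toℚᵘ-/ (ℤ.+ b) 0 ⟨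
  toℚᵘ (fromℕ b)   ∎)
  where open ℚᵘ.≤-Reasoning

fromℕ-/ : ∀ a r → fromℕ (suc r) ℚ.* (ℤ.+ a ℚ./ suc r) ≡ fromℕ a
fromℕ-/ a r = ℚ.toℚᵘ-injective (begin
  toℚᵘ (fromℕ (suc r) ℚ.* (ℤ.+ a ℚ./ suc r))       ≈⟨ ℚ.toℚᵘ-homo-* (fromℕ (suc r)) (ℤ.+ a ℚ./ suc r) ⟩
  toℚᵘ (fromℕ (suc r)) ℚᵘ.* toℚᵘ (ℤ.+ a ℚ./ suc r) ≈⟨ ℚᵘ.*-cong (toℚᵘ-/ (ℤ.+ suc r) 0) (toℚᵘ-/ (ℤ.+ a) r) ⟩
  mkℚᵘ (ℤ.+ suc r) 0 ℚᵘ.* mkℚᵘ (ℤ.+ a) r             ≈⟨ *≡* numerators ⟩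
  mkℚᵘ (ℤ.+ a) 0                                   ≈⟨ toℚᵘ-/ (ℤ.+ a) 0 ⟨
  toℚᵘ (fromℕ a)                                 ∎)
  where
  open ℚᵘ.≃-Reasoning
  numerators : ℤ.+ suc r ℤ.* ℤ.+ a ℤ.* ℤ.+ 1 ≡ ℤ.+ a ℤ.* ℤ.+ (1 * suc r)
  numerators = trans (ℤ.*-identityʳ _) (trans (ℤ.*-comm (ℤ.+ suc r) (ℤ.+ a))
                     (cong (λ x → ℤ.+ a ℤ.* ℤ.+ x) (sym (*-identityˡ (suc r)))))

-- Multiplication by `suc r` clears the fractions in a(r,c): the part 1 - 1/r turns into r - 1,
-- which is the `r` of the code.
bound-*r : ∀ r t c s → fromℕ (suc r) ℚ.* (((ℤ.+ t ℚ./ suc r) ℚ.+ a (suc r) (suc c)) ℚ.* fromℕ s)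
         ≡ fromℕ ((t + r * c + suc r * (suc r ^ suc r * c)) * s)
bound-*r r t c s = begin
  R ℚ.* ((z ℚ.+ (q ℚ.+ 1ℚ ℚ.- i) ℚ.* (fromℕ (suc c) ℚ.- 1ℚ)) ℚ.* S)
    ≡⟨ cong (λ x → R ℚ.* ((z ℚ.+ (q ℚ.+ 1ℚ ℚ.- i) ℚ.* (x ℚ.- 1ℚ)) ℚ.* S)) (fromℕ-+ 1 c) ⟩
  R ℚ.* ((z ℚ.+ (q ℚ.+ 1ℚ ℚ.- i) ℚ.* (1ℚ ℚ.+ C ℚ.- 1ℚ)) ℚ.* S)
    -- The fractions `z` and `i` are opaque to the solver; it brings `R` next to them so that
    -- `fromℕ-/` can cancel.
    ≡⟨ solve 6 (λ R z q i C S → R :* ((z :+ (q :+ con 1ℚ :- i) :* (con 1ℚ :+ C :- con 1ℚ)) :* S)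
                            := (R :* z :+ (R :* q :+ R :- R :* i) :* C) :* S) refl R z q i C S ⟩
  (R ℚ.* z ℚ.+ (R ℚ.* q ℚ.+ R ℚ.- R ℚ.* i) ℚ.* C) ℚ.* S
    ≡⟨ cong₂ (λ x y → (x ℚ.+ (R ℚ.* q ℚ.+ R ℚ.- y) ℚ.* C) ℚ.* S) (fromℕ-/ t r) (fromℕ-/ 1 r) ⟩
  (fromℕ t ℚ.+ (R ℚ.* q ℚ.+ R ℚ.- 1ℚ) ℚ.* C) ℚ.* S
    ≡⟨ cong (λ x → (fromℕ t ℚ.+ (R ℚ.* q ℚ.+ x ℚ.- 1ℚ) ℚ.* C) ℚ.* S) (fromℕ-+ 1 r) ⟩
  (fromℕ t ℚ.+ (R ℚ.* q ℚ.+ (1ℚ ℚ.+ fromℕ r) ℚ.- 1ℚ) ℚ.* C) ℚ.* S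
    ≡⟨ solve 6 (λ R t q r C S → (t :+ (R :* q :+ (con 1ℚ :+ r) :- con 1ℚ) :* C) :* S
                            := (t :+ r :* C :+ R :* (q :* C)) :* S) refl R (fromℕ t) q (fromℕ r) C S ⟩
  (fromℕ t ℚ.+ fromℕ r ℚ.* C ℚ.+ R ℚ.* (q ℚ.* C)) ℚ.* S
    ≡⟨ cong (ℚ._* S) (cong₂ ℚ._+_ (trans (fromℕ-+ t (r * c)) (cong (fromℕ t ℚ.+_) (fromℕ-* r c)))
                                  (trans (fromℕ-* (suc r) (Q * c)) (cong (R ℚ.*_) (fromℕ-* Q c)))) ⟨
  (fromℕ (t + r * c) ℚ.+ fromℕ (suc r * (Q * c))) ℚ.* S
    ≡⟨ cong (ℚ._* S) (fromℕ-+ (t + r * c) (suc r * (Q * c))) ⟨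
  fromℕ (t + r * c + suc r * (Q * c)) ℚ.* S
    ≡⟨ fromℕ-* (t + r * c + suc r * (Q * c)) s ⟨
  fromℕ ((t + r * c + suc r * (Q * c)) * s) ∎
  where
  open ≡-Reasoning
  open +-*-Solver
  Q = suc r ^ suc r
  R = fromℕ (suc r)
  z = ℤ.+ t ℚ./ suc r
  q = fromℕ Q
  i = ℤ.+ 1 ℚ./ suc r
  C = fromℕ c
  S = fromℕ s

theorem1 : (r t c : ℕ) → .{{_ : NonZero r}} → r ≥ 2 → t ≥ c → c ≥ 1 →
    {m : ℕ} (T : RGraph r m) → TightTree T → e T ≡ t →
    (k : ℕ) → MinTrunkSize T k → k ℕ.≤ c →
    {n : ℕ} (G : RGraph r n) → ¬ Contains G T →
    fromℕ (e G) ℚ.≤ ((ℤ.+ t ℤ.- ℤ.+ 1) ℚ./ r ℚ.+ a r c) ℚ.* fromℕ (e (∂ G))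
theorem1 (suc r) zero    .zero   _ z≤n ()
theorem1 (suc r) (suc t) zero    _ _   ()
theorem1 (suc r) (suc t) (suc c) _ _ _ T _ ∣T∣≡ k minimum k≤c G T⊄G
  with MinTrunkSize.attained minimum
... | T′ , trunk-T , ∣T′∣≡k =
  ℚ.*-cancelˡ-≤-pos (fromℕ (suc r)) {{ℚ.normalize-pos (suc r) 1}} (begin
    fromℕ (suc r) ℚ.* fromℕ (e G)        ≡⟨ fromℕ-* (suc r) (e G) ⟨
    fromℕ (suc r * e G)                  ≡⟨ cong fromℕ (*-comm (suc r) (e G)) ⟩
    fromℕ (e G * suc r)                  ≤⟨ fromℕ-mono (few-edges T T′ trunk-T ∣T∣≡
                                              (subst (_≤ suc c) (sym ∣T′∣≡k) k≤c) G T⊄G) ⟩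
    fromℕ ((t + r * c + suc r * (suc r ^ suc r * c)) * e (∂ G))
                                         ≡⟨ bound-*r r t c (e (∂ G)) ⟨
    fromℕ (suc r) ℚ.* (((ℤ.+ t ℚ./ suc r) ℚ.+ a (suc r) (suc c)) ℚ.* fromℕ (e (∂ G))) ∎)
  where open ℚ.≤-Reasoning
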